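{- For any positive integers $r$ and $s$, there is a tight chiral polyhedron of type $\{8r, 32s\}$.
   Context: An (abstract) polyhedron is a partially ordered set whose elements have rank $0$, $1$, $2$ (vertices, edges, faces), incidence meaning comparability, such that every edge is incident to exactly two vertices and two faces, whenever a vertex is incident to a face exactly two edges are incident to both, the incidence graph is connected, and for each vertex or face the subgraph of the incidence graph induced on its neighbours is connected. A flag is a mutually incident (vertex, edge, face) triple; $\Phi^i$ is the flag differing from $\Phi$ exactly in its rank-$i$ element. Type $\{p,q\}$: faces are incident to $p$ edges and vertices to $q$ edges. An automorphism is an incidence-preserving bijection. The polyhedron is chiral if its flags split into two classes with $\Phi,\Phi^i$ always in different classes and the automorphism group transitive on each class but not on all flags. A polyhedron of type $\{p,q\}$ is tight if it has exactly $2pq$ flags. -}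

module Defs where

open import Level using (0ℓ)
open import Data.Nat using (ℕ; _*_)
open import Data.Fin using (Fin; zero; suc) renaming (_<_ to _<ᶠ_)
open import Data.Bool using (Bool)
open import Data.Product using (Σ; _×_; _,_; proj₁; ∃)
open import Data.Sum using (_⊎_)
open import Relation.Nullary using (¬_)
open import Relation.Binary.PropositionalEquality using (_≡_; _≢_)
open import Relation.Binary.Construct.Closure.ReflexiveTransitive using (Star)
open import Function.Bundles using (_↔_)

r0 r1 r2 : Fin 3
r0 = zero
r1 = suc zero
r2 = suc (suc zero)

-- A ranked poset whose elements have rank 0, 1 or 2.
-- The incidence relation _≤_ is required to be proof-irrelevant
-- (a mere proposition), so that counting subtypes counts elements.
record RankedPoset : Set₁ where
  field
    Elem      : Set
    _≤_       : Elem → Elem → Set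
    ≤-prop    : ∀ {x y} (a b : x ≤ y) → a ≡ b
    ≤-refl    : ∀ x → x ≤ x
    ≤-trans   : ∀ {x y z} → x ≤ y → y ≤ z → x ≤ z
    ≤-antisym : ∀ {x y} → x ≤ y → y ≤ x → x ≡ y
    rank      : Elem → Fin 3
    rank-mono : ∀ {x y} → x ≤ y → x ≢ y → rank x <ᶠ rank y

module _ (P : RankedPoset) where
  open RankedPoset P

  Incident : Elem → Elem → Set
  Incident x y = x ≤ y ⊎ y ≤ x

  Adj : Elem → Elem → Set
  Adj x y = x ≢ y × Incident x y

  Connected : Set
  Connected = ∀ x y → Star Adj x y

  Nbr : Elem → Set
  Nbr x = Σ Elem (λ y → Adj x y)

  NbrAdj : (x : Elem) → Nbr x → Nbr x → Set
  NbrAdj x a b = Adj (proj₁ a) (proj₁ b)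

  LocallyConnected : Elem → Set
  LocallyConnected x = ∀ a b → Star (NbrAdj x) a b

  IncOfRank : Fin 3 → Elem → Set
  IncOfRank i x = Σ Elem (λ y → rank y ≡ i × Incident x y)

  EdgesBetween : Elem → Elem → Set
  EdgesBetween v f = Σ Elem (λ e → rank e ≡ r1 × v ≤ e × e ≤ f)

  record IsPolyhedron : Set where
    field
      edge-vertices : ∀ e → rank e ≡ r1 → IncOfRank r0 e ↔ Fin 2
      edge-faces    : ∀ e → rank e ≡ r1 → IncOfRank r2 e ↔ Fin 2
      diamond       : ∀ v f → rank v ≡ r0 → rank f ≡ r2 → v ≤ f →
                      EdgesBetween v f ↔ Fin 2
      connected     : Connected
      vertex-local  : ∀ v → rank v ≡ r0 → LocallyConnected v
      face-local    : ∀ f → rank f ≡ r2 → LocallyConnected f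

  HasType : ℕ → ℕ → Set
  HasType p q = (∀ f → rank f ≡ r2 → IncOfRank r1 f ↔ Fin p)
              × (∀ v → rank v ≡ r0 → IncOfRank r1 v ↔ Fin q)

  record Flag : Set where
    constructor flag
    field
      vtx  : Elem
      edg  : Elem
      fac  : Elem
      vtx-rank : rank vtx ≡ r0
      edg-rank : rank edg ≡ r1
      fac-rank : rank fac ≡ r2
      v≤e : vtx ≤ edg
      e≤f : edg ≤ fac
      v≤f : vtx ≤ fac

  comp : Fin 3 → Flag → Elem
  comp zero Φ = Flag.vtx Φ
  comp (suc zero) Φ = Flag.edg Φ
  comp (suc (suc zero)) Φ = Flag.fac Φ

  IsAdjFlag : Fin 3 → Flag → Flag → Set
  IsAdjFlag i Φ Ψ = comp i Φ ≢ comp i Ψ × (∀ j → j ≢ i → comp j Φ ≡ comp j Ψ)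

  record Automorphism : Set where
    field
      to      : Elem → Elem
      from    : Elem → Elem
      to-from : ∀ x → to (from x) ≡ x
      from-to : ∀ x → from (to x) ≡ x
      mono    : ∀ {x y} → x ≤ y → to x ≤ to y
      reflect : ∀ {x y} → to x ≤ to y → x ≤ y

  MapsFlag : Automorphism → Flag → Flag → Set
  MapsFlag σ Φ Ψ = ∀ i → Automorphism.to σ (comp i Φ) ≡ comp i Ψ

  FlagTransitive : Set
  FlagTransitive = ∀ Φ Ψ → Σ Automorphism (λ σ → MapsFlag σ Φ Ψ)

  Chiral : Set
  Chiral = Σ (Flag → Bool) (λ cls →
             (∀ i Φ Ψ → IsAdjFlag i Φ Ψ → cls Φ ≢ cls Ψ)
           × (∀ Φ Ψ → cls Φ ≡ cls Ψ → Σ Automorphism (λ σ → MapsFlag σ Φ Ψ))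
           × ¬ FlagTransitive)

  TightOfType : ℕ → ℕ → Set
  TightOfType p q = HasType p q × (Flag ↔ Fin (2 * p * q))

Polyhedron : Set₁
Polyhedron = Σ RankedPoset IsPolyhedron

{-# OPTIONS --safe #-}
module Submission where

-- In a tight polyhedron every vertex lies on every face. Number the vertices by ℤ/8r and the faces by
-- ℤ/32s so that the rotation α about face 0 acts on the vertices as v ↦ v + 1 and the rotation β about
-- vertex 0 acts on the faces as f ↦ f + 1. We look for rotations such that x = α² and y = β² generate
-- a group where [x , y] = xᶜyᶜ is a central involution, with β x β⁻¹ = xᴷ⁻¹yˡ, α y α⁻¹ = x⁻ᴷy⁻¹⁻ˡ and
-- c = Kl. Writing v and f as 2i or 2i + 1 and 2j or 2j + 1, with i ∈ ℤ/4r and j ∈ ℤ/16s, makes incidence,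
-- α and β affine in i and j. These maps are consistent if K and l are even, K² = 2K + Kl and 2Kl = 16sK = 0
-- modulo 4r, and l² = −2l + Kl and 2Kl = 4rl = 0 modulo 16s. An automorphism that interchanges the two
-- classes of flags would act as v ↦ −v and f ↦ −f, which forces Kl = 0 modulo both 4r and 16s. Suitable
-- K and l with Kl ≠ 0 are obtained from an integer E that is 1 modulo a power of 2 and 0 modulo the odd
-- parts of r and s.

open import Defs
open import Data.Bool using (Bool; true; false; not; _xor_; _≟_)
open import Data.Bool.Properties using (not-¬; ¬-not; not-involutive)
open import Data.Empty using (⊥; ⊥-elim)
open import Data.Fin using (Fin; zero; suc; toℕ; fromℕ<) renaming (_<_ to _<ᶠ_)
open import Data.Fin.Properties using (toℕ-injective; toℕ-fromℕ<; toℕ<n; 2↔Bool; *↔×)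
open import Data.Integer as ℤ using (ℤ; +_; 0ℤ; 1ℤ; -1ℤ)
open import Data.Integer.DivMod using (n%ℕd<d; a≡a%ℕn+[a/ℕn]*n)
open import Data.Integer.Divisibility.Signed using (_∣_; divides; ∣-trans; ∣⇒∣ᵤ; ∣m∣n⇒∣m+n; ∣m∣n⇒∣m-n; ∣m⇒∣-m; ∣n⇒∣m*n; *-cancelˡ-∣; *-monoʳ-∣)
import Data.Integer.Properties as ℤ
open import Data.Integer.Tactic.RingSolver using (solve-∀)
open import Data.Nat as ℕ using (ℕ; zero; suc; NonZero; _⊔_; s≤s; z≤n)
open import Data.Nat.Divisibility as ℕ using (∣1⇒≡1)
open import Data.Nat.Induction using (<-rec)
import Data.Nat.Properties as ℕ
open import Data.Nat.Tactic.RingSolver using () renaming (solve-∀ to ℕ-solve-∀)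
open import Data.Product using (Σ; _×_; _,_; proj₁; proj₂; ∃; ∃₂)
open import Data.Product.Function.NonDependent.Propositional using (_×-↔_)
open import Data.Sum using (_⊎_; inj₁; inj₂)
open import Function.Base using (_∘_)
open import Function.Bundles using (_↔_; mk↔ₛ′)
open import Function.Properties.Inverse using (↔-sym; ↔-trans; ↔-refl)
open import Relation.Binary.Construct.Closure.ReflexiveTransitive using (Star; ε; _◅_; _◅◅_; reverse; gmap)
open import Relation.Binary.PropositionalEquality using (_≡_; _≢_; refl; sym; trans; cong; cong₂; subst; subst₂)
open import Relation.Nullary using (¬_; yes; no; contradiction)

-- The numbers 8 and 32 come from chirality. With K = 2κ and l = 2μ the relations become congruences
-- modulo r and S = 4s, and κμ must not vanish modulo both. The parameters are c and c ± E, where 2c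
-- is a common multiple of r and S and E is odd. So c(c ± E) is an odd multiple of c exactly when c
-- is even, that is, when 4 divides 2c. The factor 4 in S ensures this for all r and s. The
-- identities between affine maps are needed for all r and s at once. Their coefficients are
-- integral combinations of 1, K, l and Kl. With K and l as symbols subject only to the relations,
-- each identity equates two normal forms with literal coefficients, and evaluation decides it.
-- Chirality has to exclude every automorphism that exchanges the classes, not only affine ones. An
-- arbitrary automorphism swapping the two base edges is followed edge by edge around face 0 and
-- vertex 0, which determines it on all vertices and faces. A further edge at vertex 0 and one at
-- face 0 then give the contradiction.

xor-cancelˡ : ∀ a {b c} → a xor b ≡ a xor c → b ≡ c
xor-cancelˡ false eq = eq
xor-cancelˡ true {false} {false} eq = refl
xor-cancelˡ true {true} {true} eq = refl

xor-cancelʳ : ∀ {a b} c → a xor c ≡ b xor c → a ≡ b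
xor-cancelʳ {false} {false} c eq = refl
xor-cancelʳ {true} {true} c eq = refl
xor-cancelʳ {false} {true} false ()
xor-cancelʳ {false} {true} true ()
xor-cancelʳ {true} {false} false ()
xor-cancelʳ {true} {false} true ()

xor-involˡ : ∀ a b → a xor (a xor b) ≡ b
xor-involˡ false b = refl
xor-involˡ true b = not-involutive b

not-xor : ∀ a b → not a xor b ≡ not (a xor b)
not-xor false b = refl
not-xor true b = sym (not-involutive b)

xor-not : ∀ a b → a xor not b ≡ not (a xor b)
xor-not false b = refl
xor-not true b = refl

-- The poset of a 2-coloured geometry

-- Vertices and faces are 2-coloured, and an edge has one vertex and one face of each colour.
-- The colour of an edge is the colour of the face that it pairs with its vertex of colour false;
-- the exclusive or of the three colours of a flag then tells its orientation.
record Geometry (I J : Set) : Set where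
  field
    vertexOf : Bool → Bool × (I × J) → I
    faceOf   : Bool → Bool × (I × J) → J
    join     : Bool → Bool → Bool → I × J → I × J
    vertexOf-join : ∀ s t k x → vertexOf s (k , join s t k x) ≡ proj₁ x
    faceOf-join   : ∀ s t k x → faceOf t (k , join s t k x) ≡ proj₂ x
    join-unique   : ∀ s t k x → join s t k (vertexOf s (k , x) , faceOf t (k , x)) ≡ x

module GeometryPoset {I J : Set} (G : Geometry I J) where
  open Geometry G

  Vertex Edge Face : Set
  Vertex = Bool × I
  Edge   = Bool × (I × J)
  Face   = Bool × J

  data Elem : Set where
    vert : Vertex → Elem
    edge : Edge → Elem
    face : Face → Elem

  _onV_ : Vertex → Edge → Set
  (s , i) onV e = vertexOf s e ≡ i

  _onF_ : Face → Edge → Set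
  (t , j) onF e = faceOf t e ≡ j

  data _≤_ : Elem → Elem → Set where
    x≤x : ∀ {x} → x ≤ x
    v≤e : ∀ {v e} → v onV e → vert v ≤ edge e
    e≤f : ∀ {e f} → f onF e → edge e ≤ face f
    v≤f : ∀ {v f} → vert v ≤ face f

  rank : Elem → Fin 3
  rank (vert _) = r0
  rank (edge _) = r1
  rank (face _) = r2

  P : RankedPoset
  P = record
    { Elem = Elem
    ; _≤_ = _≤_
    ; ≤-prop = prop
    ; ≤-refl = λ _ → x≤x
    ; ≤-trans = tr
    ; ≤-antisym = antisym
    ; rank = rank
    ; rank-mono = mono
    }
    where
    prop : ∀ {x y} (a b : x ≤ y) → a ≡ b
    prop x≤x x≤x = refl
    prop (v≤e refl) (v≤e refl) = refl
    prop (e≤f refl) (e≤f refl) = refl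
    prop v≤f v≤f = refl
    tr : ∀ {x y z} → x ≤ y → y ≤ z → x ≤ z
    tr x≤x b = b
    tr (v≤e p) x≤x = v≤e p
    tr (v≤e p) (e≤f q) = v≤f
    tr (e≤f p) x≤x = e≤f p
    tr v≤f x≤x = v≤f
    antisym : ∀ {x y} → x ≤ y → y ≤ x → x ≡ y
    antisym x≤x _ = refl
    antisym (v≤e _) ()
    antisym (e≤f _) ()
    antisym v≤f ()
    mono : ∀ {x y} → x ≤ y → x ≢ y → rank x <ᶠ rank y
    mono x≤x n = ⊥-elim (n refl)
    mono (v≤e _) _ = s≤s z≤n
    mono (e≤f _) _ = s≤s (s≤s z≤n)
    mono v≤f _ = s≤s z≤n

  orientation : Vertex → Face → Edge → Bool
  orientation (s , _) (t , _) (k , _) = s xor (t xor k)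

  -- The two edges between a vertex and a face differ in colour, so the orientation `κ` of the
  -- resulting flag tells them apart; `k` is the solution of `s xor (t xor k) ≡ κ`.
  edgeAt : Vertex → Face → Bool → Edge
  edgeAt (s , i) (t , j) κ = let k = t xor (s xor κ) in k , join s t k (i , j)

  edgeAt-vertex : ∀ v f κ → v onV edgeAt v f κ
  edgeAt-vertex (s , i) (t , j) κ = vertexOf-join s t _ (i , j)

  edgeAt-face : ∀ v f κ → f onF edgeAt v f κ
  edgeAt-face (s , i) (t , j) κ = faceOf-join s t _ (i , j)

  edgeAt-unique : ∀ v f e {κ} → v onV e → f onF e → orientation v f e ≡ κ → e ≡ edgeAt v f κ
  edgeAt-unique (s , i) (t , j) (k , x) refl refl refl =
    trans (cong (k ,_) (sym (join-unique s t k x)))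
          (cong (λ k′ → k′ , join s t k′ (vertexOf s (k , x) , faceOf t (k , x))) (sym back))
    where
    back : t xor (s xor (s xor (t xor k))) ≡ k
    back = trans (cong (t xor_) (xor-involˡ s _)) (xor-involˡ t k)

  orientation-edgeAt : ∀ v f κ → orientation v f (edgeAt v f κ) ≡ κ
  orientation-edgeAt (s , _) (t , _) κ = trans (cong (s xor_) (xor-involˡ t _)) (xor-involˡ s κ)

  -- Flags and numbers of incident elements

  FlagCode : Set
  FlagCode = Bool × Bool × Edge

  encode : FlagCode → Flag P
  encode (s , t , e) =
    flag (vert (s , vertexOf s e)) (edge e) (face (t , faceOf t e)) refl refl refl (v≤e refl) (e≤f refl) v≤f

  decode : Flag P → FlagCode
  decode (flag (vert (s , _)) (edge e) (face (t , _)) _ _ _ _ _ _) = s , t , e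
  decode (flag (edge _) _ _ () _ _ _ _ _)
  decode (flag (face _) _ _ () _ _ _ _ _)
  decode (flag (vert _) (vert _) _ _ () _ _ _ _)
  decode (flag (vert _) (face _) _ _ () _ _ _ _)
  decode (flag (vert _) (edge _) (vert _) _ _ () _ _ _)
  decode (flag (vert _) (edge _) (edge _) _ _ () _ _ _)

  encode-decode : ∀ Φ → encode (decode Φ) ≡ Φ
  encode-decode (flag (vert _) (edge _) (face _) refl refl refl (v≤e refl) (e≤f refl) v≤f) = refl
  encode-decode (flag (edge _) _ _ () _ _ _ _ _)
  encode-decode (flag (face _) _ _ () _ _ _ _ _)
  encode-decode (flag (vert _) (vert _) _ _ () _ _ _ _)
  encode-decode (flag (vert _) (face _) _ _ () _ _ _ _)
  encode-decode (flag (vert _) (edge _) (vert _) _ _ () _ _ _)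
  encode-decode (flag (vert _) (edge _) (edge _) _ _ () _ _ _)

  flags : Flag P ↔ (Bool × Bool × Bool × (I × J))
  flags = mk↔ₛ′ decode encode (λ _ → refl) encode-decode

  edge-vertices : ∀ e → IncOfRank P r0 (edge e) ↔ Bool
  edge-vertices e = mk↔ₛ′ to (λ s → vert (s , vertexOf s e) , refl , inj₂ (v≤e refl)) (λ _ → refl) back
    where
    to : IncOfRank P r0 (edge e) → Bool
    to (vert (s , _) , _) = s
    to (edge _ , () , _)
    to (face _ , () , _)
    back : ∀ y → (vert (to y , vertexOf (to y) e) , refl , inj₂ (v≤e refl)) ≡ y
    back (vert _ , refl , inj₂ (v≤e refl)) = refl
    back (edge _ , () , _)
    back (face _ , () , _)

  edge-faces : ∀ e → IncOfRank P r2 (edge e) ↔ Bool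
  edge-faces e = mk↔ₛ′ to (λ t → face (t , faceOf t e) , refl , inj₁ (e≤f refl)) (λ _ → refl) back
    where
    to : IncOfRank P r2 (edge e) → Bool
    to (face (t , _) , _) = t
    to (edge _ , () , _)
    to (vert _ , () , _)
    back : ∀ y → (face (to y , faceOf (to y) e) , refl , inj₁ (e≤f refl)) ≡ y
    back (face _ , refl , inj₁ (e≤f refl)) = refl
    back (edge _ , () , _)
    back (vert _ , () , _)

  edges-between : ∀ v f → EdgesBetween P (vert v) (face f) ↔ Bool
  edges-between (s , i) (t , j) = mk↔ₛ′ to from (λ _ → refl) back
    where
    to : EdgesBetween P (vert (s , i)) (face (t , j)) → Bool
    to (edge (k , _) , _) = k
    to (vert _ , () , _)
    to (face _ , () , _)
    from : Bool → EdgesBetween P (vert (s , i)) (face (t , j))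
    from k = edge (k , join s t k (i , j)) , refl
           , v≤e (vertexOf-join s t k (i , j)) , e≤f (faceOf-join s t k (i , j))
    same : ∀ {e e′} (p : vertexOf s e ≡ i) (q : faceOf t e ≡ j) (p′ : vertexOf s e′ ≡ i) (q′ : faceOf t e′ ≡ j) →
           e ≡ e′ → _≡_ {A = EdgesBetween P (vert (s , i)) (face (t , j))}
                        (edge e , refl , v≤e p , e≤f q) (edge e′ , refl , v≤e p′ , e≤f q′)
    same refl refl refl refl refl = refl
    back : ∀ y → from (to y) ≡ y
    back (edge (k , x) , refl , v≤e refl , e≤f refl) =
      same _ _ _ _ (cong (k ,_) (join-unique s t k x))
    back (vert _ , () , _)
    back (face _ , () , _)

  -- On a fixed face, an edge of given colour is determined by its vertex of colour `false`, and
  -- this vertex is arbitrary because every vertex lies on every face.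
  face-edges : ∀ f → IncOfRank P r1 (face f) ↔ (Bool × I)
  face-edges (t , j) = mk↔ₛ′ to from (λ (k , i) → cong (k ,_) (vertexOf-join false t k (i , j))) back
    where
    to : IncOfRank P r1 (face (t , j)) → Bool × I
    to (edge (k , x) , _) = k , vertexOf false (k , x)
    to (vert _ , () , _)
    to (face _ , () , _)
    from : Bool × I → IncOfRank P r1 (face (t , j))
    from (k , i) = edge (k , join false t k (i , j)) , refl , inj₂ (e≤f (faceOf-join false t k (i , j)))
    same : ∀ {e e′} (q : faceOf t e ≡ j) (q′ : faceOf t e′ ≡ j) → e ≡ e′ →
           _≡_ {A = IncOfRank P r1 (face (t , j))} (edge e , refl , inj₂ (e≤f q)) (edge e′ , refl , inj₂ (e≤f q′))
    same refl refl refl = refl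
    back : ∀ y → from (to y) ≡ y
    back (edge (k , x) , refl , inj₂ (e≤f refl)) = same _ _ (cong (k ,_) (join-unique false t k x))
    back (vert _ , () , _)
    back (face _ , () , _)

  vertex-edges : ∀ v → IncOfRank P r1 (vert v) ↔ (Bool × J)
  vertex-edges (s , i) = mk↔ₛ′ to from (λ (k , j) → cong (k ,_) (faceOf-join s false k (i , j))) back
    where
    to : IncOfRank P r1 (vert (s , i)) → Bool × J
    to (edge (k , x) , _) = k , faceOf false (k , x)
    to (vert _ , () , _)
    to (face _ , () , _)
    from : Bool × J → IncOfRank P r1 (vert (s , i))
    from (k , j) = edge (k , join s false k (i , j)) , refl , inj₁ (v≤e (vertexOf-join s false k (i , j)))
    same : ∀ {e e′} (q : vertexOf s e ≡ i) (q′ : vertexOf s e′ ≡ i) → e ≡ e′ →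
           _≡_ {A = IncOfRank P r1 (vert (s , i))} (edge e , refl , inj₁ (v≤e q)) (edge e′ , refl , inj₁ (v≤e q′))
    same refl refl refl = refl
    back : ∀ y → from (to y) ≡ y
    back (edge (k , x) , refl , inj₁ (v≤e refl)) = same _ _ (cong (k ,_) (join-unique s false k x))
    back (vert _ , () , _)
    back (face _ , () , _)

  -- Connectedness, global and local

  FaceStep : Vertex → Face → Face → Set
  FaceStep v f g = Σ Edge (λ e → v onV e × f onF e × g onF e)

  VertexStep : Face → Vertex → Vertex → Set
  VertexStep f v w = Σ Edge (λ e → f onF e × v onV e × w onV e)

  Adj-sym : ∀ {x y} → Adj P x y → Adj P y x
  Adj-sym (n , inj₁ p) = (n ∘ sym) , inj₂ p
  Adj-sym (n , inj₂ p) = (n ∘ sym) , inj₁ p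

  connected : Vertex → Face → Connected P
  connected v₀ f₀ x y = there x ◅◅ reverse Adj-sym (there y)
    where
    there : ∀ x → Star (Adj P) x (face f₀)
    there (vert v) = ((λ ()) , inj₁ v≤f) ◅ ε
    there (face f) = ((λ ()) , inj₂ (v≤f {v₀})) ◅ ((λ ()) , inj₁ v≤f) ◅ ε
    there (edge e) = ((λ ()) , inj₂ (v≤e {false , vertexOf false e} refl)) ◅ ((λ ()) , inj₁ v≤f) ◅ ε

  vertex-local : ∀ v → (∀ f g → Star (FaceStep v) f g) → LocallyConnected P (vert v)
  vertex-local v conn a b =
    let (f , p) = toFace a ; (g , q) = toFace b in
    p ◅◅ along (conn f g) ◅◅ reverse Adj-sym q
    where
    canonical : Face → Nbr P (vert v)
    canonical f = face f , (λ ()) , inj₁ v≤f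
    edgeNbr : ∀ e → v onV e → Nbr P (vert v)
    edgeNbr e p = edge e , (λ ()) , inj₁ (v≤e p)
    along : ∀ {f g} → Star (FaceStep v) f g → Star (NbrAdj P (vert v)) (canonical f) (canonical g)
    along ε = ε
    along ((e , p , q , q′) ◅ rest) =
      _◅_ {j = edgeNbr e p} ((λ ()) , inj₂ (e≤f q)) (((λ ()) , inj₁ (e≤f q′)) ◅ along rest)
    toFace : ∀ a → Σ Face (λ f → Star (NbrAdj P (vert v)) a (canonical f))
    toFace (vert w , n , inj₁ x≤x) = ⊥-elim (n refl)
    toFace (vert w , n , inj₂ x≤x) = ⊥-elim (n refl)
    toFace (edge e , _) = (false , faceOf false e) , ((λ ()) , inj₁ (e≤f refl)) ◅ ε
    -- A neighbour includes its proof of adjacency, which need not be the one chosen in `canonical`;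
    -- hence even a face reaches its canonical copy by way of an edge.
    toFace (face f , _) = f , _◅_ {j = edgeNbr (edgeAt v f false) (edgeAt-vertex v f false)}
      ((λ ()) , inj₂ (e≤f (edgeAt-face v f false))) (((λ ()) , inj₁ (e≤f (edgeAt-face v f false))) ◅ ε)

  face-local : ∀ f → (∀ v w → Star (VertexStep f) v w) → LocallyConnected P (face f)
  face-local f conn a b =
    let (v , p) = toVertex a ; (w , q) = toVertex b in
    p ◅◅ along (conn v w) ◅◅ reverse Adj-sym q
    where
    canonical : Vertex → Nbr P (face f)
    canonical v = vert v , (λ ()) , inj₂ v≤f
    edgeNbr : ∀ e → f onF e → Nbr P (face f)
    edgeNbr e p = edge e , (λ ()) , inj₂ (e≤f p)
    along : ∀ {v w} → Star (VertexStep f) v w → Star (NbrAdj P (face f)) (canonical v) (canonical w)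
    along ε = ε
    along ((e , p , q , q′) ◅ rest) =
      _◅_ {j = edgeNbr e p} ((λ ()) , inj₁ (v≤e q)) (((λ ()) , inj₂ (v≤e q′)) ◅ along rest)
    toVertex : ∀ a → Σ Vertex (λ v → Star (NbrAdj P (face f)) a (canonical v))
    toVertex (face g , n , inj₁ x≤x) = ⊥-elim (n refl)
    toVertex (face g , n , inj₂ x≤x) = ⊥-elim (n refl)
    toVertex (edge e , _) = (false , vertexOf false e) , ((λ ()) , inj₂ (v≤e refl)) ◅ ε
    toVertex (vert v , _) = v , _◅_ {j = edgeNbr (edgeAt v f false) (edgeAt-face v f false)}
      ((λ ()) , inj₁ (v≤e (edgeAt-vertex v f false))) (((λ ()) , inj₂ (v≤e (edgeAt-vertex v f false))) ◅ ε)

  -- Symmetries and their action on flags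

  record Symmetry : Set where
    field
      onVertex onVertex⁻ : Vertex → Vertex
      onEdge onEdge⁻ : Edge → Edge
      onFace onFace⁻ : Face → Face
      vertex-inverseˡ : ∀ v → onVertex (onVertex⁻ v) ≡ v
      vertex-inverseʳ : ∀ v → onVertex⁻ (onVertex v) ≡ v
      edge-inverseˡ : ∀ e → onEdge (onEdge⁻ e) ≡ e
      edge-inverseʳ : ∀ e → onEdge⁻ (onEdge e) ≡ e
      face-inverseˡ : ∀ f → onFace (onFace⁻ f) ≡ f
      face-inverseʳ : ∀ f → onFace⁻ (onFace f) ≡ f
      onV-mono : ∀ v e → v onV e → onVertex v onV onEdge e
      onF-mono : ∀ f e → f onF e → onFace f onF onEdge e
      onV-mono⁻ : ∀ v e → v onV e → onVertex⁻ v onV onEdge⁻ e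
      onF-mono⁻ : ∀ f e → f onF e → onFace⁻ f onF onEdge⁻ e
      orientation-preserving : ∀ v f e →
        orientation (onVertex v) (onFace f) (onEdge e) ≡ orientation v f e

    automorphism : Automorphism P
    automorphism = record
      { to = to ; from = from ; to-from = to-from ; from-to = from-to ; mono = mono
      ; reflect = λ {x} {y} p → subst₂ _≤_ (from-to x) (from-to y) (mono⁻ p) }
      where
      to from : Elem → Elem
      to (vert v) = vert (onVertex v)
      to (edge e) = edge (onEdge e)
      to (face f) = face (onFace f)
      from (vert v) = vert (onVertex⁻ v)
      from (edge e) = edge (onEdge⁻ e)
      from (face f) = face (onFace⁻ f)
      to-from : ∀ x → to (from x) ≡ x
      to-from (vert v) = cong vert (vertex-inverseˡ v)
      to-from (edge e) = cong edge (edge-inverseˡ e)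
      to-from (face f) = cong face (face-inverseˡ f)
      from-to : ∀ x → from (to x) ≡ x
      from-to (vert v) = cong vert (vertex-inverseʳ v)
      from-to (edge e) = cong edge (edge-inverseʳ e)
      from-to (face f) = cong face (face-inverseʳ f)
      mono : ∀ {x y} → x ≤ y → to x ≤ to y
      mono x≤x = x≤x
      mono (v≤e p) = v≤e (onV-mono _ _ p)
      mono (e≤f p) = e≤f (onF-mono _ _ p)
      mono v≤f = v≤f
      mono⁻ : ∀ {x y} → x ≤ y → from x ≤ from y
      mono⁻ x≤x = x≤x
      mono⁻ (v≤e p) = v≤e (onV-mono⁻ _ _ p)
      mono⁻ (e≤f p) = e≤f (onF-mono⁻ _ _ p)
      mono⁻ v≤f = v≤f

  _⇒_ : Flag P → Flag P → Set
  Φ ⇒ Ψ = Σ (Automorphism P) (λ σ → MapsFlag P σ Φ Ψ)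

  ⇒-refl : ∀ {Φ} → Φ ⇒ Φ
  ⇒-refl = record
    { to = λ x → x ; from = λ x → x ; to-from = λ _ → refl ; from-to = λ _ → refl
    ; mono = λ p → p ; reflect = λ p → p } , λ _ → refl

  ⇒-trans : ∀ {Φ Ψ Ω} → Φ ⇒ Ψ → Ψ ⇒ Ω → Φ ⇒ Ω
  ⇒-trans (σ , m) (τ , n) = record
    { to = λ x → τ.to (σ.to x) ; from = λ x → σ.from (τ.from x)
    ; to-from = λ x → trans (cong τ.to (σ.to-from _)) (τ.to-from x)
    ; from-to = λ x → trans (cong σ.from (τ.from-to _)) (σ.from-to x)
    ; mono = λ p → τ.mono (σ.mono p) ; reflect = λ p → σ.reflect (τ.reflect p) }
    , λ i → trans (cong τ.to (m i)) (n i)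
    where
    module σ = Automorphism σ
    module τ = Automorphism τ

  ⇒-sym : ∀ {Φ Ψ} → Φ ⇒ Ψ → Ψ ⇒ Φ
  ⇒-sym (σ , m) = record
    { to = from ; from = to ; to-from = from-to ; from-to = to-from
    ; mono = λ p → reflect (subst₂ _≤_ (sym (to-from _)) (sym (to-from _)) p)
    ; reflect = λ p → subst₂ _≤_ (to-from _) (to-from _) (mono p) }
    , λ i → trans (cong from (sym (m i))) (from-to _)
    where open Automorphism σ

  flagAt : Vertex → Face → Bool → Flag P
  flagAt v f κ = flag (vert v) (edge (edgeAt v f κ)) (face f) refl refl refl
    (v≤e (edgeAt-vertex v f κ)) (e≤f (edgeAt-face v f κ)) v≤f

  -- The image of the edge lies on the images of `v` and `f`. Of the two edges there, preservation
  -- of orientation selects the one with the same `κ`.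
  symmetry-flagAt : (σ : Symmetry) → ∀ v f κ →
    flagAt v f κ ⇒ flagAt (Symmetry.onVertex σ v) (Symmetry.onFace σ f) κ
  symmetry-flagAt σ v f κ = automorphism , maps
    where
    open Symmetry σ
    maps : MapsFlag P automorphism (flagAt v f κ) (flagAt (onVertex v) (onFace f) κ)
    maps zero = refl
    maps (suc zero) = cong edge (edgeAt-unique _ _ _
      (onV-mono v _ (edgeAt-vertex v f κ)) (onF-mono f _ (edgeAt-face v f κ))
      (trans (orientation-preserving v f _) (orientation-edgeAt v f κ)))
    maps (suc (suc zero)) = refl

  flagClass : Flag P → Bool
  flagClass Φ = let (s , t , (k , _)) = decode Φ in s xor (t xor k)

  -- The identity automorphism serves: vertex, face and orientation already determine the edge of
  -- `Φ`.
  ⇒flagAt : ∀ Φ → Σ Vertex (λ v → Σ Face (λ f → flagAt v f (flagClass Φ) ⇒ Φ))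
  ⇒flagAt Φ = subst (λ Ψ → Σ Vertex (λ v → Σ Face (λ f → flagAt v f (flagClass Ψ) ⇒ Ψ))) (encode-decode Φ)
    (coded (decode Φ))
    where
    coded : ∀ c → Σ Vertex (λ v → Σ Face (λ f → flagAt v f (flagClass (encode c)) ⇒ encode c))
    coded (s , t , e) = (s , vertexOf s e) , (t , faceOf t e) ,
      (proj₁ (⇒-refl {encode (s , t , e)}) , λ
        { zero → refl
        ; (suc zero) → cong edge (sym (edgeAt-unique _ _ e refl refl refl))
        ; (suc (suc zero)) → refl })

  vert-injective : ∀ {v w} → vert v ≡ vert w → v ≡ w
  vert-injective refl = refl

  edge-injective : ∀ {e e′} → edge e ≡ edge e′ → e ≡ e′
  edge-injective refl = refl

  face-injective : ∀ {f g} → face f ≡ face g → f ≡ g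
  face-injective refl = refl

  -- If the classes agreed, cancellation would make the colours at rank `i` agree too. That colour,
  -- together with the two common elements, determines the third, so the flags would not differ
  -- there.
  flagClass-adjacent : ∀ i Φ Ψ → IsAdjFlag P i Φ Ψ → flagClass Φ ≢ flagClass Ψ
  flagClass-adjacent i Φ Ψ adj = subst₂ (λ Φ Ψ → IsAdjFlag P i Φ Ψ → flagClass Φ ≢ flagClass Ψ)
    (encode-decode Φ) (encode-decode Ψ) (coded i (decode Φ) (decode Ψ)) adj
    where
    coded : ∀ i c d → IsAdjFlag P i (encode c) (encode d) → flagClass (encode c) ≢ flagClass (encode d)
    coded zero (s , t , e@(k , _)) (s′ , t′ , e′) (differ , agree) eq
      with refl ← edge-injective (agree r1 λ ()) | refl ← cong proj₁ (face-injective (agree r2 λ ())) =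
      differ (cong (λ s → vert (s , vertexOf s e)) (xor-cancelʳ (t xor k) eq))
    coded (suc zero) (s , t , (k , x)) (s′ , t′ , (k′ , x′)) (differ , agree) eq
      with refl ← cong proj₁ (vert-injective (agree r0 λ ())) | refl ← cong proj₁ (face-injective (agree r2 λ ())) 
      with refl ← xor-cancelˡ t (xor-cancelˡ s eq) =
      differ (cong (λ x → edge (k , x)) (trans (sym (join-unique s t k x)) (trans
        (cong₂ (λ i j → join s t k (i , j)) (cong proj₂ (vert-injective (agree r0 λ ())))
                                            (cong proj₂ (face-injective (agree r2 λ ()))))
        (join-unique s t k x′))))
    coded (suc (suc zero)) (s , t , e@(k , _)) (s′ , t′ , e′) (differ , agree) eq
      with refl ← edge-injective (agree r1 λ ()) | refl ← cong proj₁ (vert-injective (agree r0 λ ())) =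
      differ (cong (λ t → face (t , faceOf t e)) (xor-cancelʳ k (xor-cancelˡ s eq)))

  -- How an arbitrary automorphism propagates along edges

  vert≢edge : ∀ {v e} → vert v ≢ edge e
  vert≢edge ()

  face≢edge : ∀ {f e} → face f ≢ edge e
  face≢edge ()

  module Reflection (τ : Automorphism P) where
    open Automorphism τ

    to-injective : ∀ {x y} → to x ≡ to y → x ≡ y
    to-injective {x} {y} eq = trans (sym (from-to x)) (trans (cong from eq) (from-to y))

    below-edge : ∀ {y e} → y ≤ edge e → y ≢ edge e → Σ Vertex (λ v → y ≡ vert v × v onV e)
    below-edge x≤x n = ⊥-elim (n refl)
    below-edge (v≤e p) _ = _ , refl , p

    above-edge : ∀ {y e} → edge e ≤ y → y ≢ edge e → Σ Face (λ f → y ≡ face f × f onF e)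
    above-edge x≤x n = ⊥-elim (n refl)
    above-edge (e≤f p) _ = _ , refl , p

    between : ∀ {y v f} → vert v ≤ y → y ≤ face f → y ≢ vert v → y ≢ face f →
              Σ Edge (λ e → y ≡ edge e × v onV e × f onF e)
    between x≤x _ n _ = ⊥-elim (n refl)
    between (v≤e p) (e≤f q) _ _ = _ , refl , p , q
    between v≤f x≤x _ n = ⊥-elim (n refl)

    -- The image of `v′` lies strictly below `e′`, so it is one of the two vertices of `e′`, and by
    -- injectivity it is not `w`. Nothing is assumed about the effect of `τ` on colours.
    opposite-vertex : ∀ {v v′ w w′ e e′} → to (edge e) ≡ edge e′ → to (vert v) ≡ vert w →
      v onV e → v′ onV e → w onV e′ → w′ onV e′ →
      proj₁ v′ ≡ not (proj₁ v) → proj₁ w′ ≡ not (proj₁ w) → to (vert v′) ≡ vert w′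
    opposite-vertex {v} {v′} {w} {w′} {e} {e′} te tv p p′ q q′ c d
      with u , tv′ , o ← below-edge (subst (to (vert v′) ≤_) te (mono (v≤e p′)))
                           (λ eq → vert≢edge (to-injective (trans eq (sym te)))) = trans tv′ (cong vert (same u o tv′))
      where
      same : ∀ u → u onV e′ → to (vert v′) ≡ vert u → u ≡ w′
      same (s , _) refl tu with s ≟ proj₁ w
      ... | yes refl = ⊥-elim (not-¬ (sym (cong proj₁ (vert-injective
                (to-injective {vert v} {vert v′} (trans tv (trans (cong vert (cong (s ,_) (sym q))) (sym tu))))))) c)
      ... | no s≢ = trans (cong (λ s → s , vertexOf s e′) (trans (¬-not s≢) (sym d))) (cong (proj₁ w′ ,_) q′)

    opposite-face : ∀ {f f′ g g′ e e′} → to (edge e) ≡ edge e′ → to (face f) ≡ face g →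
      f onF e → f′ onF e → g onF e′ → g′ onF e′ →
      proj₁ f′ ≡ not (proj₁ f) → proj₁ g′ ≡ not (proj₁ g) → to (face f′) ≡ face g′
    opposite-face {f} {f′} {g} {g′} {e} {e′} te tf p p′ q q′ c d
      with u , tf′ , o ← above-edge (subst (_≤ to (face f′)) te (mono (e≤f p′)))
                           (λ eq → face≢edge (to-injective (trans eq (sym te)))) = trans tf′ (cong face (same u o tf′))
      where
      same : ∀ u → u onF e′ → to (face f′) ≡ face u → u ≡ g′
      same (t , _) refl tu with t ≟ proj₁ g
      ... | yes refl = ⊥-elim (not-¬ (sym (cong proj₁ (face-injective
                (to-injective {face f} {face f′} (trans tf (trans (cong face (cong (t ,_) (sym q))) (sym tu))))))) c)
      ... | no t≢ = trans (cong (λ t → t , faceOf t e′) (trans (¬-not t≢) (sym d))) (cong (proj₁ g′ ,_) q′)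

    Maps : Vertex → Face → Bool → Vertex → Face → Bool → Set
    Maps v f κ w g κ′ = to (vert v) ≡ vert w × to (face f) ≡ face g × to (edge (edgeAt v f κ)) ≡ edge (edgeAt w g κ′)

    -- The image of the second edge lies strictly between `w` and `g`. Only two edges do, and
    -- injectivity excludes the one already taken.
    other-edge : ∀ v f κ w g κ′ → Maps v f κ w g κ′ → Maps v f (not κ) w g (not κ′)
    other-edge v f κ w g κ′ (tv , tf , te) with y , ty , p , q ← between
        (subst (_≤ to (edge (edgeAt v f (not κ)))) tv (mono (v≤e (edgeAt-vertex v f (not κ)))))
        (subst (to (edge (edgeAt v f (not κ))) ≤_) tf (mono (e≤f (edgeAt-face v f (not κ)))))
        (λ eq → vert≢edge (sym (to-injective (trans eq (sym tv)))))
        (λ eq → face≢edge (sym (to-injective (trans eq (sym tf))))) =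
        tv , tf , trans ty (cong edge (edgeAt-unique w g y p q (¬-not (λ o → clash
          (to-injective (trans ty (trans (cong edge (edgeAt-unique w g y p q o)) (sym te))))))))
      where
      clash : edge (edgeAt v f (not κ)) ≡ edge (edgeAt v f κ) → ⊥
      clash eq = not-¬ refl (sym (xor-cancelˡ (proj₁ v) (xor-cancelˡ (proj₁ f) (cong proj₁ (edge-injective eq)))))

  -- Rotary geometries: transitivity, connectedness and the effect of an edge swap

  record EdgeSwap (v : Vertex) (f : Face) : Set where
    field
      τ : Automorphism P
      swaps : MapsFlag P τ (flagAt v f false) (flagAt v f true)

  record Rotary : Set₁ where
    field
      α β : Symmetry
      v₀ : Vertex
      f₀ : Face

    open Symmetry α public using () renaming (onVertex to αᵛ; onFace to αᶠ; onFace⁻ to αᶠ⁻)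
    open Symmetry β public using () renaming (onVertex to βᵛ; onFace to βᶠ)

    field
      α-generates : (Q : Vertex → Set) → Q v₀ → (∀ v → Q v → Q (αᵛ v)) → ∀ v → Q v
      β-generates : (Q : Face → Set) → Q f₀ → (∀ f → Q f → Q (βᶠ f)) → ∀ f → Q f
      β-fixes-v₀ : βᵛ v₀ ≡ v₀
      α-colour : ∀ v → proj₁ (αᵛ v) ≡ not (proj₁ v)
      β-colour : ∀ f → proj₁ (βᶠ f) ≡ not (proj₁ f)
      α-edge : ∀ v → αᵛ v onV edgeAt v f₀ false
      β-edge : ∀ f → f onF edgeAt v₀ (βᶠ f) false

    base⇒flagAt : ∀ κ v f → flagAt v₀ f₀ κ ⇒ flagAt v f κ
    base⇒flagAt κ = α-generates (λ v → ∀ f → flagAt v₀ f₀ κ ⇒ flagAt v f κ)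
      (β-generates _ ⇒-refl λ f h →
        subst (λ v → flagAt v₀ f₀ κ ⇒ flagAt v (βᶠ f) κ) β-fixes-v₀ (⇒-trans h (symmetry-flagAt β v₀ f κ)))
      -- `α` moves the faces too, so the induction is over all faces at once and the target face is
      -- first pulled back by `αᶠ⁻`.
      (λ v h f → subst (λ g → flagAt v₀ f₀ κ ⇒ flagAt (αᵛ v) g κ) (Symmetry.face-inverseˡ α f)
        (⇒-trans (h (αᶠ⁻ f)) (symmetry-flagAt α v (αᶠ⁻ f) κ)))

    class-transitive : ∀ Φ Ψ → flagClass Φ ≡ flagClass Ψ → Φ ⇒ Ψ
    class-transitive Φ Ψ eq with v , f , p ← ⇒flagAt Φ | w , g , q ← ⇒flagAt Ψ =
      ⇒-trans (⇒-sym (⇒-trans (base⇒flagAt _ v f) p))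
              (subst (λ κ → flagAt v₀ f₀ κ ⇒ Ψ) (sym eq) (⇒-trans (base⇒flagAt _ w g) q))

    -- At `v₀` consecutive faces of the orbit of `β` share an edge; powers of `α` carry this to
    -- every other vertex.
    faces-connected : ∀ v f g → Star (FaceStep v) f g
    faces-connected = α-generates (λ v → ∀ f g → Star (FaceStep v) f g)
      (λ f g → reverse (λ (e , p , q , q′) → e , p , q′ , q) (from-f₀ f) ◅◅ from-f₀ g)
      (λ v h f g → subst₂ (Star (FaceStep (αᵛ v))) (Symmetry.face-inverseˡ α f) (Symmetry.face-inverseˡ α g)
        (gmap αᶠ (λ (e , p , q , q′) → Symmetry.onEdge α e , Symmetry.onV-mono α v e p
                   , Symmetry.onF-mono α _ e q , Symmetry.onF-mono α _ e q′)
              (h (αᶠ⁻ f) (αᶠ⁻ g))))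
      where
      from-f₀ : ∀ f → Star (FaceStep v₀) f₀ f
      from-f₀ = β-generates _ ε λ f h →
        h ◅◅ (edgeAt v₀ (βᶠ f) false , edgeAt-vertex v₀ (βᶠ f) false , β-edge f , edgeAt-face v₀ (βᶠ f) false) ◅ ε

    vertices-connected : ∀ f v w → Star (VertexStep f) v w
    vertices-connected = β-generates (λ f → ∀ v w → Star (VertexStep f) v w)
      (λ v w → reverse (λ (e , p , q , q′) → e , p , q′ , q) (from-v₀ v) ◅◅ from-v₀ w)
      (λ f h v w → subst₂ (Star (VertexStep (βᶠ f))) (Symmetry.vertex-inverseˡ β v) (Symmetry.vertex-inverseˡ β w)
        (gmap βᵛ (λ (e , p , q , q′) → Symmetry.onEdge β e , Symmetry.onF-mono β f e p
                   , Symmetry.onV-mono β _ e q , Symmetry.onV-mono β _ e q′)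
              (h (Symmetry.onVertex⁻ β v) (Symmetry.onVertex⁻ β w))))
      where
      from-v₀ : ∀ v → Star (VertexStep f₀) v₀ v
      from-v₀ = α-generates _ ε λ v h →
        h ◅◅ (edgeAt v f₀ false , edgeAt-face v f₀ false , edgeAt-vertex v f₀ false , α-edge v) ◅ ε

    isPolyhedron : IsPolyhedron P
    isPolyhedron = record
      { edge-vertices = λ { (edge e) refl → ↔-trans (edge-vertices e) (↔-sym 2↔Bool) }
      ; edge-faces = λ { (edge e) refl → ↔-trans (edge-faces e) (↔-sym 2↔Bool) }
      ; diamond = λ { (vert v) (face f) refl refl v≤f → ↔-trans (edges-between v f) (↔-sym 2↔Bool) }
      ; connected = connected v₀ f₀
      ; vertex-local = λ { (vert v) refl → vertex-local v (faces-connected v) }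
      ; face-local = λ { (face f) refl → face-local f (vertices-connected f) }
      }

    chiral : ¬ EdgeSwap v₀ f₀ → Chiral P
    chiral no-swap = flagClass , flagClass-adjacent , class-transitive , λ transitive →
      let (τ , swaps) = transitive (flagAt v₀ f₀ false) (flagAt v₀ f₀ true)
      in no-swap (record { τ = τ ; swaps = swaps })

    orientation-α : ∀ v f e → orientation (αᵛ v) f e ≡ not (orientation v f e)
    orientation-α v f e = trans (cong (_xor (proj₁ f xor proj₁ e)) (α-colour v)) (not-xor (proj₁ v) _)

    orientation-β : ∀ v f e → orientation v (βᶠ f) e ≡ not (orientation v f e)
    orientation-β v f e = trans (cong (proj₁ v xor_) (trans (cong (_xor proj₁ e) (β-colour f)) (not-xor (proj₁ f) _)))
                                (xor-not (proj₁ v) _)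

    edgeAt-α : ∀ v → edgeAt v f₀ false ≡ edgeAt (αᵛ v) f₀ true
    edgeAt-α v = edgeAt-unique _ _ _ (α-edge v) (edgeAt-face v f₀ false)
      (trans (orientation-α v f₀ (edgeAt v f₀ false)) (cong not (orientation-edgeAt v f₀ false)))

    edgeAt-β : ∀ f → edgeAt v₀ f true ≡ edgeAt v₀ (βᶠ f) false
    edgeAt-β f = sym (edgeAt-unique _ _ _ (edgeAt-vertex v₀ (βᶠ f) false) (β-edge f)
      (trans (sym (not-involutive _)) (cong not (trans (sym (orientation-β v₀ f (edgeAt v₀ (βᶠ f) false)))
        (orientation-edgeAt v₀ (βᶠ f) false)))))

    -- An automorphism that fixes v₀ and f₀ and swaps the two edges between them reverses the
    -- cyclic orders of the vertices of f₀ and of the faces at v₀.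
    module Reversal (swap : EdgeSwap v₀ f₀)
      (ν : Vertex → Vertex) (ν-v₀ : ν v₀ ≡ v₀) (ν-α : ∀ v → αᵛ (ν (αᵛ v)) ≡ ν v)
      (φ : Face → Face) (φ-f₀ : φ f₀ ≡ f₀) (φ-β : ∀ f → βᶠ (φ (βᶠ f)) ≡ φ f) where
      open EdgeSwap swap
      open Automorphism τ
      open Reflection τ

      Maps-base : Maps v₀ f₀ false v₀ f₀ true
      Maps-base = swaps r0 , swaps r2 , swaps r1

      Maps-along-f₀ : ∀ v → Maps v f₀ false (ν v) f₀ true
      Maps-along-f₀ = α-generates _ (subst (λ w → Maps v₀ f₀ false w f₀ true) (sym ν-v₀) Maps-base) step
        where
        step : ∀ v → Maps v f₀ false (ν v) f₀ true → Maps (αᵛ v) f₀ false (ν (αᵛ v)) f₀ true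
        -- The edge from `v` to `αᵛ v` goes to the edge from `ν v` back to its predecessor `w` under
        -- `α`. Seen from its far end an edge has the opposite orientation, so `other-edge` is what
        -- turns to the next edge of `f₀`.
        step v (tv , tf , te) = other-edge (αᵛ v) f₀ true w f₀ false
          (opposite-vertex te′ tv (edgeAt-vertex v f₀ false) (α-edge v) w-on (edgeAt-vertex w f₀ false) (α-colour v)
             (trans (sym (not-involutive _)) (cong not (trans (sym (α-colour w)) (cong proj₁ (ν-α v)))))
          , tf , trans (cong (λ e → to (edge e)) (sym (edgeAt-α v))) te′)
          where
          w : Vertex
          w = ν (αᵛ v)
          w-edge : edgeAt (ν v) f₀ true ≡ edgeAt w f₀ false
          w-edge = trans (cong (λ u → edgeAt u f₀ true) (sym (ν-α v))) (sym (edgeAt-α w))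
          te′ : to (edge (edgeAt v f₀ false)) ≡ edge (edgeAt w f₀ false)
          te′ = trans te (cong edge w-edge)
          w-on : ν v onV edgeAt w f₀ false
          w-on = subst (λ u → u onV edgeAt w f₀ false) (ν-α v) (α-edge w)

      Maps-along-v₀ : ∀ f → Maps v₀ f false v₀ (φ f) true
      Maps-along-v₀ = β-generates _ (subst (λ g → Maps v₀ f₀ false v₀ g true) (sym φ-f₀) Maps-base) step
        where
        step : ∀ f → Maps v₀ f false v₀ (φ f) true → Maps v₀ (βᶠ f) false v₀ (φ (βᶠ f)) true
        step f m with tv , tf , te ← other-edge v₀ f false v₀ (φ f) true m =
          tv
          , opposite-face te tf (edgeAt-face v₀ f true) f-on (edgeAt-face v₀ (φ f) false) g-on (β-colour f)
             (trans (sym (not-involutive _)) (cong not (trans (sym (β-colour g)) (cong proj₁ (φ-β f)))))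
          , trans (cong (λ e → to (edge e)) (sym (edgeAt-β f))) (trans te (cong edge (sym g-edge)))
          where
          g : Face
          g = φ (βᶠ f)
          g-edge : edgeAt v₀ g true ≡ edgeAt v₀ (φ f) false
          g-edge = trans (edgeAt-β g) (cong (λ h → edgeAt v₀ h false) (φ-β f))
          f-on : βᶠ f onF edgeAt v₀ f true
          f-on = subst (βᶠ f onF_) (sym (edgeAt-β f)) (edgeAt-face v₀ (βᶠ f) false)
          g-on : g onF edgeAt v₀ (φ f) false
          g-on = subst (g onF_) g-edge (edgeAt-face v₀ g true)

      -- Two computations of the image of `v` must agree: one follows the vertices of `f₀`, the
      -- other follows the faces at `v₀` up to `f` and crosses an edge there. This compatibility is
      -- what an edge swap can violate.
      reversal-vertex : ∀ f v w → v onV edgeAt v₀ f false → proj₁ v ≡ not (proj₁ v₀) →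
        w onV edgeAt v₀ (φ f) true → proj₁ w ≡ not (proj₁ v₀) → ν v ≡ w
      reversal-vertex f v w p c q d with tv , tf , te ← Maps-along-v₀ f =
        vert-injective (trans (sym (proj₁ (Maps-along-f₀ v)))
          (opposite-vertex te tv (edgeAt-vertex v₀ f false) p (edgeAt-vertex v₀ (φ f) true) q c d))

      reversal-face : ∀ v f g → f onF edgeAt v f₀ false → proj₁ f ≡ not (proj₁ f₀) →
        g onF edgeAt (ν v) f₀ true → proj₁ g ≡ not (proj₁ f₀) → φ f ≡ g
      reversal-face v f g p c q d with tv , tf , te ← Maps-along-f₀ v =
        face-injective (trans (sym (proj₁ (proj₂ (Maps-along-v₀ f))))
          (opposite-face te tf (edgeAt-face v f₀ false) p (edgeAt-face (ν v) f₀ true) q c d))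

module _ where

  open import Data.Integer using (_+_; _*_; _-_; -_; _%ℕ_; _/ℕ_)

  -- Integers modulo n

  module Residues (n : ℕ) .{{_ : NonZero n}} where

    infix 4 _≈_
    record _≈_ (x y : ℤ) : Set where
      constructor congruent
      field
        difference : + n ∣ x - y

    [_] : ℤ → Fin n
    [ x ] = fromℕ< (n%ℕd<d x n)

    rep : Fin n → ℤ
    rep i = + toℕ i

    ≈-reflexive : ∀ {x y} → x ≡ y → x ≈ y
    ≈-reflexive {x} refl = congruent (divides 0ℤ (ℤ.+-inverseʳ x))

    ≈-sym : ∀ {x y} → x ≈ y → y ≈ x
    ≈-sym {x} {y} (congruent p) = congruent (subst (+ n ∣_) (identity x y) (∣m⇒∣-m p))
      where
      identity : ∀ x y → - (x - y) ≡ y - x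
      identity = solve-∀

    ≈-trans : ∀ {x y z} → x ≈ y → y ≈ z → x ≈ z
    ≈-trans {x} {y} {z} (congruent p) (congruent q) = congruent (subst (+ n ∣_) (identity x y z) (∣m∣n⇒∣m+n p q))
      where
      identity : ∀ x y z → x - y + (y - z) ≡ x - z
      identity = solve-∀

    +-cong : ∀ {x x′ y y′} → x ≈ x′ → y ≈ y′ → x + y ≈ x′ + y′
    +-cong {x} {x′} {y} {y′} (congruent p) (congruent q) = congruent (subst (+ n ∣_) (identity x x′ y y′) (∣m∣n⇒∣m+n p q))
      where
      identity : ∀ x x′ y y′ → x - x′ + (y - y′) ≡ x + y - (x′ + y′)
      identity = solve-∀

    *-congˡ : ∀ u {x x′} → x ≈ x′ → u * x ≈ u * x′
    *-congˡ u {x} {x′} (congruent p) = congruent (subst (+ n ∣_) (identity u x x′) (∣n⇒∣m*n u p))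
      where
      identity : ∀ u x x′ → u * (x - x′) ≡ u * x - u * x′
      identity = solve-∀

    *-congʳ : ∀ u {x x′} → x ≈ x′ → x * u ≈ x′ * u
    *-congʳ u {x} {x′} p = subst₂ _≈_ (ℤ.*-comm u x) (ℤ.*-comm u x′) (*-congˡ u p)

    ≈⇒≡ : ∀ {a b} → a ℕ.< n → b ℕ.< n → + a ≈ + b → a ≡ b
    ≈⇒≡ {a} {b} a<n b<n (congruent p) = ℤ.+-injective (ℤ.i-j≡0⇒i≡j (+ a) (+ b) (ℤ.∣i∣≡0⇒i≡0 vanishes))
      where
      small : ℤ.∣ + a - + b ∣ ℕ.< n
      small = ℕ.≤-<-trans
        (subst (λ z → ℤ.∣ z ∣ ℕ.≤ a ⊔ b) (sym (ℤ.m-n≡m⊖n a b)) (ℤ.∣m⊝n∣≤m⊔n a b)) (ℕ.⊔-lub a<n b<n)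
      zero-of : ∀ m → m ℕ.< n → n ℕ.∣ m → m ≡ 0
      zero-of ℕ.zero _ _ = refl
      zero-of (ℕ.suc m) m<n d = contradiction d (ℕ.>⇒∤ m<n)
      vanishes : ℤ.∣ + a - + b ∣ ≡ 0
      vanishes = zero-of _ small (∣⇒∣ᵤ p)

    rep-[] : ∀ x → rep [ x ] ≈ x
    rep-[] x = ≈-sym (congruent (divides (x /ℕ n)
      (trans (cong₂ (λ x r → x - + r) (a≡a%ℕn+[a/ℕn]*n x n) (toℕ-fromℕ< (n%ℕd<d x n))) (identity (+ (x %ℕ n)) _))))
      where
      identity : ∀ r q → r + q - r ≡ q
      identity = solve-∀

    []-injective : ∀ {x y} → [ x ] ≡ [ y ] → x ≈ y
    []-injective {x} {y} eq = ≈-trans (≈-sym (rep-[] x)) (≈-trans (≈-reflexive (cong rep eq)) (rep-[] y))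

    rep-injective : ∀ {i j} → rep i ≈ rep j → i ≡ j
    rep-injective {i} {j} p = toℕ-injective (≈⇒≡ (toℕ<n i) (toℕ<n j) p)

    []-cong : ∀ {x y} → x ≈ y → [ x ] ≡ [ y ]
    []-cong {x} {y} p = rep-injective (≈-trans (rep-[] x) (≈-trans p (≈-sym (rep-[] y))))

    []-rep : ∀ i → [ rep i ] ≡ i
    []-rep i = rep-injective (rep-[] (rep i))

  -- Affine maps with symbolic coefficients

  -- ⟨ a ⨾ b ⨾ d ⟩ stands for a + b θ + d θφ in a ring where θ² = 2εθ + θφ and where 2θφ, θ²φ and θφ²
  -- vanish; the last coordinate is therefore kept modulo 2. The cross coefficient ⟨ b ⨾ d ⟩ of a row
  -- stands for b θ + d θφ.
  record Number : Set where
    constructor ⟨_⨾_⨾_⟩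
    field
      coeff-1 coeff-θ coeff-θφ : ℤ

  record CrossNumber : Set where
    constructor ⟨_⨾_⟩
    field
      coeff-θ coeff-θφ : ℤ

  parity : ℤ → ℤ
  parity x = + (x %ℕ 2)

  -- The affine map (x , y) ↦ own · x + cross · y + const; x has the modulus in which θ and φ satisfy the
  -- relations above, and y the other one, in which θ and φ exchange their roles.
  record Row : Set where
    constructor row
    field
      own   : Number
      cross : CrossNumber
      const : Number

  identityRow zeroRow : Row
  identityRow = row ⟨ 1ℤ ⨾ 0ℤ ⨾ 0ℤ ⟩ ⟨ 0ℤ ⨾ 0ℤ ⟩ ⟨ 0ℤ ⨾ 0ℤ ⨾ 0ℤ ⟩
  zeroRow     = row ⟨ 0ℤ ⨾ 0ℤ ⨾ 0ℤ ⟩ ⟨ 0ℤ ⨾ 0ℤ ⟩ ⟨ 0ℤ ⨾ 0ℤ ⨾ 0ℤ ⟩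

  pure : Row → Row
  pure (row u _ k) = row u ⟨ 0ℤ ⨾ 0ℤ ⟩ k

  shift : ℤ → Row
  shift k = row ⟨ 1ℤ ⨾ 0ℤ ⨾ 0ℤ ⟩ ⟨ 0ℤ ⨾ 0ℤ ⟩ ⟨ k ⨾ 0ℤ ⨾ 0ℤ ⟩

  scaling : Number → Row
  scaling u = row u ⟨ 0ℤ ⨾ 0ℤ ⟩ ⟨ 0ℤ ⨾ 0ℤ ⨾ 0ℤ ⟩

  infixl 6 _⊕_ _⊞_
  _⊕_ : Number → Number → Number
  ⟨ a ⨾ b ⨾ d ⟩ ⊕ ⟨ a′ ⨾ b′ ⨾ d′ ⟩ = ⟨ a + a′ ⨾ b + b′ ⨾ parity (d + d′) ⟩

  _⊞_ : CrossNumber → CrossNumber → CrossNumber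
  ⟨ b ⨾ d ⟩ ⊞ ⟨ b′ ⨾ d′ ⟩ = ⟨ b + b′ ⨾ parity (d + d′) ⟩

  embed : CrossNumber → Number
  embed ⟨ b ⨾ d ⟩ = ⟨ 0ℤ ⨾ b ⨾ d ⟩

  -- The right factor belongs to the other modulus, where its middle coefficient goes with φ; times
  -- θ it therefore contributes to θφ.
  _◃_ : CrossNumber → Number → CrossNumber
  ⟨ b ⨾ d ⟩ ◃ ⟨ a′ ⨾ b′ ⨾ _ ⟩ = ⟨ b * a′ ⨾ parity (b * b′ + d * a′) ⟩

  _⊗_ : CrossNumber → CrossNumber → Number
  ⟨ b ⨾ _ ⟩ ⊗ ⟨ b′ ⨾ _ ⟩ = ⟨ 0ℤ ⨾ 0ℤ ⨾ parity (b * b′) ⟩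

  module Twisted (ε : ℤ) where

    infixl 7 _⊙_ _▹_
    _⊙_ : Number → Number → Number
    ⟨ a ⨾ b ⨾ d ⟩ ⊙ ⟨ a′ ⨾ b′ ⨾ d′ ⟩ =
      ⟨ a * a′ ⨾ a * b′ + a′ * b + + 2 * ε * (b * b′) ⨾ parity (b * b′ + a * d′ + a′ * d) ⟩

    _▹_ : Number → CrossNumber → CrossNumber
    ⟨ a ⨾ b ⨾ _ ⟩ ▹ ⟨ b′ ⨾ d′ ⟩ = ⟨ a * b′ + + 2 * ε * (b * b′) ⨾ parity (b * b′ + a * d′) ⟩

    -- The second row produces the own coordinate, and the third, which belongs to the other
    -- modulus, the cross coordinate; the first row is applied to the two results.
    compose : Row → Row → Row → Row
    compose (row u w k) (row u′ w′ k′) (row y x m) =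
      row (u ⊙ u′ ⊕ w ⊗ x) (u ▹ w′ ⊞ w ◃ y) (u ⊙ k′ ⊕ embed (w ◃ m) ⊕ k)

  -- Evaluation of symbolic maps at residues

  module RowSemantics (n n′ : ℕ) .{{_ : NonZero n}} .{{_ : NonZero n′}} (θ′ φ′ ε : ℤ)
    (square-θ : + n ∣ + 2 * θ′ * (+ 2 * θ′) - (+ 2 * ε * (+ 2 * θ′) + + 2 * θ′ * (+ 2 * φ′)))
    (double-θφ : + n ∣ + 2 * (+ 2 * θ′ * (+ 2 * φ′)))
    (annihilates : + n ∣ + 2 * θ′ * + n′) where

    open Residues n
    private module R′ = Residues n′
    open Twisted ε

    θ φ : ℤ
    θ = + 2 * θ′
    φ = + 2 * φ′

    -- The primed readings are for rows of the other modulus. With the product written `φ * θ`, they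
    -- agree definitionally with the unprimed readings of the instance in which θ and φ are
    -- exchanged.
    ⟦_⟧ ⟦_⟧′ : Number → ℤ
    ⟦ ⟨ a ⨾ b ⨾ d ⟩ ⟧ = a + b * θ + d * (θ * φ)
    ⟦ ⟨ a ⨾ b ⨾ d ⟩ ⟧′ = a + b * φ + d * (φ * θ)

    ⟪_⟫ ⟪_⟫′ : CrossNumber → ℤ
    ⟪ ⟨ b ⨾ d ⟩ ⟫ = b * θ + d * (θ * φ)
    ⟪ ⟨ b ⨾ d ⟩ ⟫′ = b * φ + d * (φ * θ)

    by-relations : ∀ {x y} A B →
      x - y ≡ A * (θ * θ - (+ 2 * ε * θ + θ * φ)) + B * (+ 2 * (θ * φ)) → x ≈ y
    by-relations A B eq = congruent (subst (+ n ∣_) (sym eq) (∣m∣n⇒∣m+n (∣n⇒∣m*n A square-θ) (∣n⇒∣m*n B double-θφ)))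

    parity-θφ : ∀ x d → x + parity d * (θ * φ) ≈ x + d * (θ * φ)
    parity-θφ x d = by-relations 0ℤ (- (d /ℕ 2))
      (trans (cong (λ e → x + parity d * (θ * φ) - (x + e * (θ * φ))) (a≡a%ℕn+[a/ℕn]*n d 2))
             (identity x (parity d) (d /ℕ 2) (θ * φ) (θ * θ - (+ 2 * ε * θ + θ * φ))))
      where
      identity : ∀ x p q c s → x + p * c - (x + (p + q * + 2) * c) ≡ 0ℤ * s + - q * (+ 2 * c)
      identity = solve-∀

    ⊕-correct : ∀ p q → ⟦ p ⊕ q ⟧ ≈ ⟦ p ⟧ + ⟦ q ⟧
    ⊕-correct ⟨ a ⨾ b ⨾ d ⟩ ⟨ a′ ⨾ b′ ⨾ d′ ⟩ =
      ≈-trans (parity-θφ (a + a′ + (b + b′) * θ) (d + d′)) (≈-reflexive (identity a b d a′ b′ d′ θ (θ * φ)))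
      where
      identity : ∀ a b d a′ b′ d′ θ c →
        a + a′ + (b + b′) * θ + (d + d′) * c ≡ a + b * θ + d * c + (a′ + b′ * θ + d′ * c)
      identity = solve-∀

    ⊞-correct : ∀ v w → ⟪ v ⊞ w ⟫ ≈ ⟪ v ⟫ + ⟪ w ⟫
    ⊞-correct ⟨ b ⨾ d ⟩ ⟨ b′ ⨾ d′ ⟩ = ≈-trans (parity-θφ ((b + b′) * θ) (d + d′)) (≈-reflexive (identity b d b′ d′ θ (θ * φ)))
      where
      identity : ∀ b d b′ d′ θ c → (b + b′) * θ + (d + d′) * c ≡ b * θ + d * c + (b′ * θ + d′ * c)
      identity = solve-∀

    -- Replacing θ² by 2εθ + θφ accounts for the term in `b * b′`. The other surplus terms contain
    -- θ²φ, which vanishes because θ = 2θ′ makes it a multiple of 2θφ.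
    ⊙-correct : ∀ p q → ⟦ p ⊙ q ⟧ ≈ ⟦ p ⟧ * ⟦ q ⟧
    ⊙-correct ⟨ a ⨾ b ⨾ d ⟩ ⟨ a′ ⨾ b′ ⨾ d′ ⟩ = ≈-trans
      (parity-θφ (a * a′ + (a * b′ + a′ * b + + 2 * ε * (b * b′)) * θ) (b * b′ + a * d′ + a′ * d))
      (by-relations (- (b * b′)) (- (θ′ * (b * d′ + b′ * d + φ * d * d′))) (identity a b d a′ b′ d′ θ′ φ′ ε))
      where
      identity : ∀ a b d a′ b′ d′ θ′ φ′ ε → let θ = + 2 * θ′ ; φ = + 2 * φ′ in
        a * a′ + (a * b′ + a′ * b + + 2 * ε * (b * b′)) * θ + (b * b′ + a * d′ + a′ * d) * (θ * φ)
          - (a + b * θ + d * (θ * φ)) * (a′ + b′ * θ + d′ * (θ * φ))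
        ≡ - (b * b′) * (θ * θ - (+ 2 * ε * θ + θ * φ)) + - (θ′ * (b * d′ + b′ * d + φ * d * d′)) * (+ 2 * (θ * φ))
      identity = solve-∀

    ▹-correct : ∀ p w → ⟪ p ▹ w ⟫ ≈ ⟦ p ⟧ * ⟪ w ⟫
    ▹-correct ⟨ a ⨾ b ⨾ d ⟩ ⟨ b′ ⨾ d′ ⟩ = ≈-trans (parity-θφ ((a * b′ + + 2 * ε * (b * b′)) * θ) (b * b′ + a * d′))
      (by-relations (- (b * b′)) (- (θ′ * (b * d′ + b′ * d + φ * d * d′))) (identity a b d b′ d′ θ′ φ′ ε))
      where
      identity : ∀ a b d b′ d′ θ′ φ′ ε → let θ = + 2 * θ′ ; φ = + 2 * φ′ in
        (a * b′ + + 2 * ε * (b * b′)) * θ + (b * b′ + a * d′) * (θ * φ)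
          - (a + b * θ + d * (θ * φ)) * (b′ * θ + d′ * (θ * φ))
        ≡ - (b * b′) * (θ * θ - (+ 2 * ε * θ + θ * φ)) + - (θ′ * (b * d′ + b′ * d + φ * d * d′)) * (+ 2 * (θ * φ))
      identity = solve-∀

    ◃-correct : ∀ w q → ⟪ w ◃ q ⟫ ≈ ⟪ w ⟫ * ⟦ q ⟧′
    ◃-correct ⟨ b ⨾ d ⟩ ⟨ a′ ⨾ b′ ⨾ d′ ⟩ = ≈-trans (parity-θφ (b * a′ * θ) (b * b′ + d * a′))
      (by-relations 0ℤ (- (θ′ * b * d′ + φ′ * d * b′ + + 2 * θ′ * φ′ * d * d′)) (identity b d a′ b′ d′ θ′ φ′ ε))
      where
      identity : ∀ b d a′ b′ d′ θ′ φ′ ε → let θ = + 2 * θ′ ; φ = + 2 * φ′ in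
        b * a′ * θ + (b * b′ + d * a′) * (θ * φ) - (b * θ + d * (θ * φ)) * (a′ + b′ * φ + d′ * (φ * θ))
        ≡ 0ℤ * (θ * θ - (+ 2 * ε * θ + θ * φ)) + - (θ′ * b * d′ + φ′ * d * b′ + + 2 * θ′ * φ′ * d * d′) * (+ 2 * (θ * φ))
      identity = solve-∀

    ⊗-correct : ∀ w x → ⟦ w ⊗ x ⟧ ≈ ⟪ w ⟫ * ⟪ x ⟫′
    ⊗-correct ⟨ b ⨾ d ⟩ ⟨ b′ ⨾ d′ ⟩ = ≈-trans (parity-θφ (0ℤ + 0ℤ * θ) (b * b′))
      (by-relations 0ℤ (- (θ′ * b * d′ + φ′ * d * b′ + + 2 * θ′ * φ′ * d * d′)) (identity b d b′ d′ θ′ φ′ ε))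
      where
      identity : ∀ b d b′ d′ θ′ φ′ ε → let θ = + 2 * θ′ ; φ = + 2 * φ′ in
        0ℤ + 0ℤ * θ + b * b′ * (θ * φ) - (b * θ + d * (θ * φ)) * (b′ * φ + d′ * (φ * θ))
        ≡ 0ℤ * (θ * θ - (+ 2 * ε * θ + θ * φ)) + - (θ′ * b * d′ + φ′ * d * b′ + + 2 * θ′ * φ′ * d * d′) * (+ 2 * (θ * φ))
      identity = solve-∀

    embed-correct : ∀ w → ⟦ embed w ⟧ ≡ ⟪ w ⟫
    embed-correct ⟨ b ⨾ d ⟩ = cong (_+ d * (θ * φ)) (ℤ.+-identityˡ (b * θ))

    value value′ : Row → ℤ → ℤ → ℤ
    value (row u w k) x y = ⟦ u ⟧ * x + ⟪ w ⟫ * y + ⟦ k ⟧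
    value′ (row u w k) y x = ⟦ u ⟧′ * y + ⟪ w ⟫′ * x + ⟦ k ⟧′

    opaque
      eval : Row → Fin n → Fin n′ → Fin n
      eval r i j = [ value r (rep i) (R′.rep j) ]

      eval-value : ∀ r i j → eval r i j ≡ [ value r (rep i) (R′.rep j) ]
      eval-value r i j = refl

    -- A cross coefficient is a multiple of θ, and θ times `n′` vanishes modulo `n`; this makes it
    -- meaningful to multiply a residue modulo `n′` into one modulo `n`.
    cross-cong : ∀ w {y y′} → y R′.≈ y′ → ⟪ w ⟫ * y ≈ ⟪ w ⟫ * y′
    cross-cong ⟨ b ⨾ d ⟩ {y} {y′} (R′.congruent (divides q eq)) = congruent (subst (+ n ∣_)
      (trans (identity b d θ φ q (+ n′)) (trans (cong (⟪ ⟨ b ⨾ d ⟩ ⟫ *_) (sym eq)) (distrib ⟪ ⟨ b ⨾ d ⟩ ⟫ y y′)))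
      (∣n⇒∣m*n ((b + d * φ) * q) annihilates))
      where
      identity : ∀ b d θ φ q n → (b + d * φ) * q * (θ * n) ≡ (b * θ + d * (θ * φ)) * (q * n)
      identity = solve-∀
      distrib : ∀ w y y′ → w * (y - y′) ≡ w * y - w * y′
      distrib = solve-∀

    value-cong : ∀ r {x x′ y y′} → x ≈ x′ → y R′.≈ y′ → value r x y ≈ value r x′ y′
    value-cong (row u w k) p q = +-cong (+-cong (*-congˡ ⟦ u ⟧ p) (cross-cong w q)) (≈-reflexive {⟦ k ⟧} refl)

    eval-[] : ∀ r x y → eval r [ x ] R′.[ y ] ≡ [ value r x y ]
    eval-[] r x y = trans (eval-value r [ x ] R′.[ y ]) ([]-cong (value-cong r (rep-[] x) (R′.rep-[] y)))

    compose-value : ∀ r s t x y → value (compose r s t) x y ≈ value r (value s x y) (value′ t y x)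
    compose-value (row u w k) (row u′ w′ k′) (row y x m) X Y = ≈-trans
      (+-cong (+-cong
        (*-congʳ X (≈-trans (⊕-correct (u ⊙ u′) (w ⊗ x)) (+-cong (⊙-correct u u′) (⊗-correct w x))))
        (*-congʳ Y (≈-trans (⊞-correct (u ▹ w′) (w ◃ y)) (+-cong (▹-correct u w′) (◃-correct w y)))))
        (≈-trans (⊕-correct (u ⊙ k′ ⊕ embed (w ◃ m)) k) (+-cong (≈-trans (⊕-correct (u ⊙ k′) (embed (w ◃ m)))
          (+-cong (⊙-correct u k′) (≈-trans (≈-reflexive (embed-correct (w ◃ m))) (◃-correct w m)))) (≈-reflexive {⟦ k ⟧} refl))))
      (≈-reflexive (identity ⟦ u ⟧ ⟪ w ⟫ ⟦ k ⟧ ⟦ u′ ⟧ ⟪ w′ ⟫ ⟦ k′ ⟧ ⟦ y ⟧′ ⟪ x ⟫′ ⟦ m ⟧′ X Y))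
      where
      identity : ∀ u w k u′ w′ k′ y x m X Y →
        (u * u′ + w * x) * X + (u * w′ + w * y) * Y + (u * k′ + w * m + k)
        ≡ u * (u′ * X + w′ * Y + k′) + w * (y * Y + x * X + m) + k
      identity = solve-∀

    eval-compose : ∀ r s t i j i′ j′ → i′ ≡ [ value s (rep i) (R′.rep j) ] → j′ ≡ R′.[ value′ t (R′.rep j) (rep i) ] →
      eval r i′ j′ ≡ eval (compose r s t) i j
    eval-compose r s t i j i′ j′ refl refl = trans (eval-[] r (value s (rep i) (R′.rep j)) (value′ t (R′.rep j) (rep i)))
      (trans ([]-cong (≈-sym (compose-value r s t (rep i) (R′.rep j)))) (sym (eval-value (compose r s t) i j)))

    eval-identity : ∀ i j → eval identityRow i j ≡ i
    eval-identity i j = trans (eval-value identityRow i j) (trans (cong [_] (identity (rep i) (R′.rep j) θ (θ * φ))) ([]-rep i))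
      where
      identity : ∀ x y θ c → (1ℤ + 0ℤ * θ + 0ℤ * c) * x + (0ℤ * θ + 0ℤ * c) * y + (0ℤ + 0ℤ * θ + 0ℤ * c) ≡ x
      identity = solve-∀

    eval₁ : Row → Fin n → Fin n
    eval₁ r i = eval r i R′.[ 0ℤ ]

    -- A map of one coordinate is a row evaluated with the other coordinate 0. `zeroRow` supplies
    -- this 0, so such maps are composed by `compose` as well.
    eval₁-eval : ∀ r s i j → eval₁ r (eval s i j) ≡ eval (compose r s zeroRow) i j
    eval₁-eval r s i j = eval-compose r s zeroRow i j (eval s i j) R′.[ 0ℤ ] (eval-value s i j)
      (cong R′.[_] (sym (identity (R′.rep j) (rep i) φ (φ * θ))))
      where
      identity : ∀ x y θ c → (0ℤ + 0ℤ * θ + 0ℤ * c) * x + (0ℤ * θ + 0ℤ * c) * y + (0ℤ + 0ℤ * θ + 0ℤ * c) ≡ 0ℤ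
      identity = solve-∀

    eval₁-eval₁ : ∀ r s {t} → compose r s zeroRow ≡ t → ∀ i → eval₁ r (eval₁ s i) ≡ eval₁ t i
    eval₁-eval₁ r s eq i = trans (eval₁-eval r s i R′.[ 0ℤ ]) (cong (λ t → eval₁ t i) eq)

    eval₁-inverse : ∀ r s → compose r s zeroRow ≡ identityRow → ∀ i → eval₁ r (eval₁ s i) ≡ i
    eval₁-inverse r s eq i = trans (eval₁-eval₁ r s eq i) (eval-identity i R′.[ 0ℤ ])

    eval₁-pure : ∀ r i → eval₁ r i ≡ eval₁ (pure r) i
    eval₁-pure r@(row u w k) i = trans (eval-value r i R′.[ 0ℤ ]) (trans
      ([]-cong (+-cong (+-cong (≈-reflexive {⟦ u ⟧ * rep i} refl)
      (≈-trans (cross-cong w (R′.rep-[] 0ℤ)) (≈-trans (≈-reflexive (identity ⟪ w ⟫ θ (θ * φ)))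
        (≈-sym (cross-cong ⟨ 0ℤ ⨾ 0ℤ ⟩ (R′.rep-[] 0ℤ)))))) (≈-reflexive {⟦ k ⟧} refl)))
        (sym (eval-value (pure r) i R′.[ 0ℤ ])))
      where
      identity : ∀ w θ c → w * 0ℤ ≡ (0ℤ * θ + 0ℤ * c) * 0ℤ
      identity = solve-∀

    eval₁-shift : ∀ k x → eval₁ (shift k) [ x ] ≡ [ k + x ]
    eval₁-shift k x = trans (eval-[] (shift k) x 0ℤ) (cong [_] (identity k x θ (θ * φ)))
      where
      identity : ∀ k x θ c → (1ℤ + 0ℤ * θ + 0ℤ * c) * x + (0ℤ * θ + 0ℤ * c) * 0ℤ + (k + 0ℤ * θ + 0ℤ * c) ≡ k + x
      identity = solve-∀

    eval₁-scaling : ∀ u → eval₁ (scaling u) [ 0ℤ ] ≡ [ 0ℤ ]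
    eval₁-scaling u = trans (eval-[] (scaling u) 0ℤ 0ℤ) (cong [_] (identity ⟦ u ⟧ θ (θ * φ)))
      where
      identity : ∀ u θ c → u * 0ℤ + (0ℤ * θ + 0ℤ * c) * 0ℤ + (0ℤ + 0ℤ * θ + 0ℤ * c) ≡ 0ℤ
      identity = solve-∀

    -- The pair `(s , i)` encodes 2i or 2i + 1. Adding 1 keeps `i` when it leaves an even number and
    -- raises it when it leaves an odd one, whence `identityRow` and `shift 1ℤ`.
    every-residue : (Q : Bool → Fin n → Set) → Q false [ 0ℤ ] → (∀ i → Q false i → Q true (eval₁ identityRow i)) →
      (∀ i → Q true i → Q false (eval₁ (shift 1ℤ) i)) → ∀ s i → Q s i
    every-residue Q base odd even = λ { false i → subst (Q false) ([]-rep i) (evens (toℕ i))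
                                      ; true i → subst (Q true) ([]-rep i) (odds (toℕ i)) }
      where
      evens : ∀ k → Q false [ + k ]
      odds : ∀ k → Q true [ + k ]
      evens ℕ.zero = base
      evens (ℕ.suc k) = subst (Q false) (eval₁-shift 1ℤ (+ k)) (even [ + k ] (odds k))
      odds k = subst (Q true) (eval-identity [ + k ] R′.[ 0ℤ ]) (odd [ + k ] (evens k))

  -- Incidence maps and the two rotations

  open Twisted 1ℤ using () renaming (compose to composeᵛ)
  open Twisted -1ℤ using () renaming (compose to composeᶠ)

  AffineMap : Set
  AffineMap = Row × Row

  infixr 9 _∘ᵃ_
  _∘ᵃ_ : AffineMap → AffineMap → AffineMap
  (r , s) ∘ᵃ (r′ , s′) = composeᵛ r r′ s′ , composeᶠ s s′ r′

  identityᵃ : AffineMap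
  identityᵃ = identityRow , identityRow

  -- θ = K and φ = l in the rows for vertices, and θ = l and φ = K in those for
  -- faces. An edge of colour k is given by the coordinates of its vertex of colour false and of its
  -- face of colour k.
  vertexRow : Bool → Bool → Row
  vertexRow false _     = identityRow
  vertexRow true  false = row ⟨ 1ℤ ⨾ 0ℤ ⨾ 0ℤ ⟩ ⟨ -1ℤ ⨾ 1ℤ ⟩ ⟨ 0ℤ ⨾ 0ℤ ⨾ 0ℤ ⟩
  vertexRow true  true  = row ⟨ 1ℤ ⨾ 0ℤ ⨾ 1ℤ ⟩ ⟨ -1ℤ ⨾ 0ℤ ⟩ ⟨ -1ℤ ⨾ 0ℤ ⨾ 0ℤ ⟩

  faceRow : Bool → Bool → Row
  faceRow false false = identityRow
  faceRow true  true  = identityRow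
  faceRow true  false = row ⟨ 1ℤ ⨾ 0ℤ ⨾ 0ℤ ⟩ ⟨ 1ℤ ⨾ 0ℤ ⟩ ⟨ -1ℤ ⨾ 0ℤ ⨾ 0ℤ ⟩
  faceRow false true  = row ⟨ 1ℤ ⨾ 0ℤ ⨾ 0ℤ ⟩ ⟨ -1ℤ ⨾ 1ℤ ⟩ ⟨ 0ℤ ⨾ 0ℤ ⨾ 0ℤ ⟩

  -- The solution of the two linear equations given by `cornerMap s t k`. Their determinant is 1 or
  -- 1 + Kl, which is its own inverse since 2Kl and (Kl)² vanish.
  joinMap : Bool → Bool → Bool → AffineMap
  joinMap false false false = identityᵃ
  joinMap false true  true  = identityᵃ
  joinMap false true  false = identityRow , row ⟨ 1ℤ ⨾ 0ℤ ⨾ 0ℤ ⟩ ⟨ -1ℤ ⨾ 0ℤ ⟩ ⟨ 1ℤ ⨾ 0ℤ ⨾ 0ℤ ⟩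
  joinMap false false true  = identityRow , row ⟨ 1ℤ ⨾ 0ℤ ⨾ 0ℤ ⟩ ⟨ 1ℤ ⨾ 1ℤ ⟩ ⟨ 0ℤ ⨾ 0ℤ ⨾ 0ℤ ⟩
  joinMap true  false false = row ⟨ 1ℤ ⨾ 0ℤ ⨾ 0ℤ ⟩ ⟨ 1ℤ ⨾ 1ℤ ⟩ ⟨ 0ℤ ⨾ 0ℤ ⨾ 0ℤ ⟩ , identityRow
  joinMap true  true  true  = row ⟨ 1ℤ ⨾ 0ℤ ⨾ 1ℤ ⟩ ⟨ 1ℤ ⨾ 0ℤ ⟩ ⟨ 1ℤ ⨾ 0ℤ ⨾ 1ℤ ⟩ , identityRow
  joinMap true  true  false = row ⟨ 1ℤ ⨾ 0ℤ ⨾ 1ℤ ⟩ ⟨ 1ℤ ⨾ 1ℤ ⟩ ⟨ 0ℤ ⨾ 1ℤ ⨾ 1ℤ ⟩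
                            , row ⟨ 1ℤ ⨾ 0ℤ ⨾ 1ℤ ⟩ ⟨ -1ℤ ⨾ 0ℤ ⟩ ⟨ 1ℤ ⨾ 0ℤ ⨾ 1ℤ ⟩
  joinMap true  false true  = row ⟨ 1ℤ ⨾ 0ℤ ⨾ 0ℤ ⟩ ⟨ 1ℤ ⨾ 0ℤ ⟩ ⟨ 1ℤ ⨾ 0ℤ ⨾ 0ℤ ⟩
                            , row ⟨ 1ℤ ⨾ 0ℤ ⨾ 1ℤ ⟩ ⟨ 1ℤ ⨾ 1ℤ ⟩ ⟨ 0ℤ ⨾ 1ℤ ⨾ 1ℤ ⟩

  cornerMap : Bool → Bool → Bool → AffineMap
  cornerMap s t k = vertexRow s k , faceRow t k

  -- Both sides evaluate to the same literal coefficients, since the last one is reduced modulo 2.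
  -- The identity thus holds for all moduli together.
  corner-join : ∀ s t k → cornerMap s t k ∘ᵃ joinMap s t k ≡ identityᵃ
  corner-join false false false = refl
  corner-join false false true  = refl
  corner-join false true  false = refl
  corner-join false true  true  = refl
  corner-join true  false false = refl
  corner-join true  false true  = refl
  corner-join true  true  false = refl
  corner-join true  true  true  = refl

  join-corner : ∀ s t k → joinMap s t k ∘ᵃ cornerMap s t k ≡ identityᵃ
  join-corner false false false = refl
  join-corner false false true  = refl
  join-corner false true  false = refl
  join-corner false true  true  = refl
  join-corner true  false false = refl
  join-corner true  false true  = refl
  join-corner true  true  false = refl
  join-corner true  true  true  = refl

  -- Only symmetries that flip the colours of all edges are needed.
  record SymmetryTable : Set where
    field
      flipᵛ flipᶠ : Bool
      flips : ∀ s t k → (flipᵛ xor s) xor ((flipᶠ xor t) xor not k) ≡ s xor (t xor k)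
      rowᵛ rowᵛ⁻ rowᶠ rowᶠ⁻ : Bool → Row
      mapᵉ mapᵉ⁻ : Bool → AffineMap
      inverseᵛˡ : ∀ s → composeᵛ (rowᵛ (flipᵛ xor s)) (rowᵛ⁻ s) zeroRow ≡ identityRow
      inverseᵛʳ : ∀ s → composeᵛ (rowᵛ⁻ (flipᵛ xor s)) (rowᵛ s) zeroRow ≡ identityRow
      inverseᶠˡ : ∀ t → composeᶠ (rowᶠ (flipᶠ xor t)) (rowᶠ⁻ t) zeroRow ≡ identityRow
      inverseᶠʳ : ∀ t → composeᶠ (rowᶠ⁻ (flipᶠ xor t)) (rowᶠ t) zeroRow ≡ identityRow
      inverseᵉˡ : ∀ k → mapᵉ (not k) ∘ᵃ mapᵉ⁻ k ≡ identityᵃ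
      inverseᵉʳ : ∀ k → mapᵉ⁻ (not k) ∘ᵃ mapᵉ k ≡ identityᵃ
      onVertexRow : ∀ s k → composeᵛ (vertexRow (flipᵛ xor s) (not k)) (proj₁ (mapᵉ k)) (proj₂ (mapᵉ k))
                            ≡ composeᵛ (rowᵛ s) (vertexRow s k) zeroRow
      onFaceRow : ∀ t k → composeᶠ (faceRow (flipᶠ xor t) (not k)) (proj₂ (mapᵉ k)) (proj₁ (mapᵉ k))
                          ≡ composeᶠ (rowᶠ t) (faceRow t k) zeroRow
      onVertexRow⁻ : ∀ s k → composeᵛ (vertexRow (flipᵛ xor s) (not k)) (proj₁ (mapᵉ⁻ k)) (proj₂ (mapᵉ⁻ k))
                             ≡ composeᵛ (rowᵛ⁻ s) (vertexRow s k) zeroRow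
      onFaceRow⁻ : ∀ t k → composeᶠ (faceRow (flipᶠ xor t) (not k)) (proj₂ (mapᵉ⁻ k)) (proj₁ (mapᵉ⁻ k))
                           ≡ composeᶠ (rowᶠ⁻ t) (faceRow t k) zeroRow

  -- The rotation v ↦ v + 1 about the base face.
  αTable : SymmetryTable
  αTable = record
    { flipᵛ = true
    ; flipᶠ = false
    ; flips = λ { false false k → not-involutive k ; false true k → cong not (not-involutive k)
                ; true false k → refl ; true true k → refl }
    ; rowᵛ = λ { false → identityRow ; true → shift 1ℤ }
    ; rowᵛ⁻ = λ { false → shift -1ℤ ; true → identityRow }
    ; rowᶠ = rowᶠ
    ; rowᶠ⁻ = rowᶠ⁻
    -- `α` flips the colours of vertices and edges but not of faces. The corner of the image that
    -- serves as its coordinates is thus the image of the corner with vertex colour `true` and face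
    -- colour `not k`.
    ; mapᵉ = λ { false → (shift 1ℤ , rowᶠ true) ∘ᵃ cornerMap true true false
               ; true → (shift 1ℤ , rowᶠ false) ∘ᵃ cornerMap true false true }
    ; mapᵉ⁻ = λ { true → joinMap true true false ∘ᵃ (shift -1ℤ , rowᶠ⁻ true)
                ; false → joinMap true false true ∘ᵃ (shift -1ℤ , rowᶠ⁻ false) }
    ; inverseᵛˡ = λ { false → refl ; true → refl }
    ; inverseᵛʳ = λ { false → refl ; true → refl }
    ; inverseᶠˡ = λ { false → refl ; true → refl }
    ; inverseᶠʳ = λ { false → refl ; true → refl }
    ; inverseᵉˡ = λ { false → refl ; true → refl }
    ; inverseᵉʳ = λ { false → refl ; true → refl }
    ; onVertexRow = λ { false false → refl ; false true → refl ; true false → refl ; true true → refl }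
    ; onFaceRow = λ { false false → refl ; false true → refl ; true false → refl ; true true → refl }
    ; onVertexRow⁻ = λ { false false → refl ; false true → refl ; true false → refl ; true true → refl }
    ; onFaceRow⁻ = λ { false false → refl ; false true → refl ; true false → refl ; true true → refl }
    }
    where
    rowᶠ rowᶠ⁻ : Bool → Row
    -- In the modulus of the faces (1 + l)² = 1 + Kl, so -(1 + l) and -(1 + l + Kl) are inverse to
    -- each other. Likewise (K - 1)² = 1 + Kl in the modulus of the vertices, which gives the
    -- inverses for `β`.
    rowᶠ false = scaling ⟨ -1ℤ ⨾ -1ℤ ⨾ 0ℤ ⟩
    rowᶠ true  = row ⟨ -1ℤ ⨾ -1ℤ ⨾ 1ℤ ⟩ ⟨ 0ℤ ⨾ 0ℤ ⟩ ⟨ -1ℤ ⨾ 0ℤ ⨾ 0ℤ ⟩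
    rowᶠ⁻ false = scaling ⟨ -1ℤ ⨾ -1ℤ ⨾ 1ℤ ⟩
    rowᶠ⁻ true  = row ⟨ -1ℤ ⨾ -1ℤ ⨾ 0ℤ ⟩ ⟨ 0ℤ ⨾ 0ℤ ⟩ ⟨ -1ℤ ⨾ -1ℤ ⨾ 0ℤ ⟩

  -- The rotation f ↦ f + 1 about the base vertex.
  βTable : SymmetryTable
  βTable = record
    { flipᵛ = false
    ; flipᶠ = true
    ; flips = λ { false false k → not-involutive k ; false true k → refl
                ; true false k → cong not (not-involutive k) ; true true k → refl }
    ; rowᵛ = λ { false → scaling ⟨ -1ℤ ⨾ 1ℤ ⨾ 0ℤ ⟩
               ; true → row ⟨ -1ℤ ⨾ 1ℤ ⨾ 1ℤ ⟩ ⟨ 0ℤ ⨾ 0ℤ ⟩ ⟨ -1ℤ ⨾ 0ℤ ⨾ 0ℤ ⟩ }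
    ; rowᵛ⁻ = λ { false → scaling ⟨ -1ℤ ⨾ 1ℤ ⨾ 1ℤ ⟩
                ; true → row ⟨ -1ℤ ⨾ 1ℤ ⨾ 0ℤ ⟩ ⟨ 0ℤ ⨾ 0ℤ ⟩ ⟨ -1ℤ ⨾ 1ℤ ⨾ 0ℤ ⟩ }
    ; rowᶠ = λ { false → identityRow ; true → shift 1ℤ }
    ; rowᶠ⁻ = λ { false → shift -1ℤ ; true → identityRow }
    -- `β` keeps vertex colours and flips those of faces and edges, so the corner that gives the
    -- coordinates of an edge goes to the corner that gives those of its image.
    ; mapᵉ = λ { false → scaling ⟨ -1ℤ ⨾ 1ℤ ⨾ 0ℤ ⟩ , identityRow
               ; true → scaling ⟨ -1ℤ ⨾ 1ℤ ⨾ 0ℤ ⟩ , shift 1ℤ }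
    ; mapᵉ⁻ = λ { true → scaling ⟨ -1ℤ ⨾ 1ℤ ⨾ 1ℤ ⟩ , identityRow
                ; false → scaling ⟨ -1ℤ ⨾ 1ℤ ⨾ 1ℤ ⟩ , shift -1ℤ }
    ; inverseᵛˡ = λ { false → refl ; true → refl }
    ; inverseᵛʳ = λ { false → refl ; true → refl }
    ; inverseᶠˡ = λ { false → refl ; true → refl }
    ; inverseᶠʳ = λ { false → refl ; true → refl }
    ; inverseᵉˡ = λ { false → refl ; true → refl }
    ; inverseᵉʳ = λ { false → refl ; true → refl }
    ; onVertexRow = λ { false false → refl ; false true → refl ; true false → refl ; true true → refl }
    ; onFaceRow = λ { false false → refl ; false true → refl ; true false → refl ; true true → refl }
    ; onVertexRow⁻ = λ { false false → refl ; false true → refl ; true false → refl ; true true → refl }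
    ; onFaceRow⁻ = λ { false false → refl ; false true → refl ; true false → refl ; true true → refl }
    }

  -- The polyhedron belonging to given parameters

  module Model (m n : ℕ) .{{_ : NonZero m}} .{{_ : NonZero n}} (κ μ : ℤ)
    (square-κ : + m ∣ + 2 * κ * (+ 2 * κ) - (+ 2 * 1ℤ * (+ 2 * κ) + + 2 * κ * (+ 2 * μ)))
    (square-μ : + n ∣ + 2 * μ * (+ 2 * μ) - (+ 2 * -1ℤ * (+ 2 * μ) + + 2 * μ * (+ 2 * κ)))
    (double-κμ : + m ∣ + 2 * (+ 2 * κ * (+ 2 * μ)))
    (double-μκ : + n ∣ + 2 * (+ 2 * μ * (+ 2 * κ)))
    (annihilates-κ : + m ∣ + 2 * κ * + n)
    (annihilates-μ : + n ∣ + 2 * μ * + m) where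

    module V = RowSemantics m n κ μ 1ℤ square-κ double-κμ annihilates-κ
    module F = RowSemantics n m μ κ -1ℤ square-μ double-μκ annihilates-μ
    module M = Residues m
    module N = Residues n

    apply : AffineMap → Fin m × Fin n → Fin m × Fin n
    apply (r , s) (i , j) = V.eval r i j , F.eval s j i

    V-compose : ∀ r s t i j → V.eval r (V.eval s i j) (F.eval t j i) ≡ V.eval (composeᵛ r s t) i j
    V-compose r s t i j = V.eval-compose r s t i j (V.eval s i j) (F.eval t j i) (V.eval-value s i j) (F.eval-value t j i)

    F-compose : ∀ r s t j i → F.eval r (F.eval s j i) (V.eval t i j) ≡ F.eval (composeᶠ r s t) j i
    F-compose r s t j i = F.eval-compose r s t j i (F.eval s j i) (V.eval t i j) (F.eval-value s j i) (V.eval-value t i j)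

    apply-∘ : ∀ a b x → apply a (apply b x) ≡ apply (a ∘ᵃ b) x
    apply-∘ (r , s) (r′ , s′) (i , j) = cong₂ _,_ (V-compose r r′ s′ i j) (F-compose s s′ r′ j i)

    apply-identity : ∀ x → apply identityᵃ x ≡ x
    apply-identity (i , j) = cong₂ _,_ (V.eval-identity i j) (F.eval-identity j i)

    apply-inverse : ∀ a b → a ∘ᵃ b ≡ identityᵃ → ∀ x → apply a (apply b x) ≡ x
    apply-inverse a b eq x = trans (apply-∘ a b x) (trans (cong (λ c → apply c x) eq) (apply-identity x))

    geometry : Geometry (Fin m) (Fin n)
    geometry = record
      { vertexOf = λ s (k , i , j) → V.eval (vertexRow s k) i j
      ; faceOf = λ t (k , i , j) → F.eval (faceRow t k) j i
      ; join = λ s t k → apply (joinMap s t k)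
      ; vertexOf-join = λ s t k x → cong proj₁ (apply-inverse (cornerMap s t k) (joinMap s t k) (corner-join s t k) x)
      ; faceOf-join = λ s t k x → cong proj₂ (apply-inverse (cornerMap s t k) (joinMap s t k) (corner-join s t k) x)
      ; join-unique = λ s t k x → apply-inverse (joinMap s t k) (cornerMap s t k) (join-corner s t k) x
      }

    open GeometryPoset geometry

    symmetry : SymmetryTable → Symmetry
    symmetry T = record
      { onVertex = λ (s , i) → flipᵛ xor s , V.eval₁ (rowᵛ s) i
      ; onVertex⁻ = λ (s , i) → flipᵛ xor s , V.eval₁ (rowᵛ⁻ s) i
      ; onEdge = λ (k , x) → not k , apply (mapᵉ k) x
      ; onEdge⁻ = λ (k , x) → not k , apply (mapᵉ⁻ k) x
      ; onFace = λ (t , j) → flipᶠ xor t , F.eval₁ (rowᶠ t) j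
      ; onFace⁻ = λ (t , j) → flipᶠ xor t , F.eval₁ (rowᶠ⁻ t) j
      ; vertex-inverseˡ = λ (s , i) → cong₂ _,_
          (xor-involˡ flipᵛ s) (V.eval₁-inverse (rowᵛ (flipᵛ xor s)) (rowᵛ⁻ s) (inverseᵛˡ s) i)
      ; vertex-inverseʳ = λ (s , i) → cong₂ _,_
          (xor-involˡ flipᵛ s) (V.eval₁-inverse (rowᵛ⁻ (flipᵛ xor s)) (rowᵛ s) (inverseᵛʳ s) i)
      ; edge-inverseˡ = λ (k , x) → cong₂ _,_ (not-involutive k) (apply-inverse (mapᵉ (not k)) (mapᵉ⁻ k) (inverseᵉˡ k) x)
      ; edge-inverseʳ = λ (k , x) → cong₂ _,_ (not-involutive k) (apply-inverse (mapᵉ⁻ (not k)) (mapᵉ k) (inverseᵉʳ k) x)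
      ; face-inverseˡ = λ (t , j) → cong₂ _,_
          (xor-involˡ flipᶠ t) (F.eval₁-inverse (rowᶠ (flipᶠ xor t)) (rowᶠ⁻ t) (inverseᶠˡ t) j)
      ; face-inverseʳ = λ (t , j) → cong₂ _,_
          (xor-involˡ flipᶠ t) (F.eval₁-inverse (rowᶠ⁻ (flipᶠ xor t)) (rowᶠ t) (inverseᶠʳ t) j)
      ; onV-mono = λ { (s , _) (k , x) refl → vertices rowᵛ mapᵉ onVertexRow s k x }
      ; onF-mono = λ { (t , _) (k , x) refl → faces rowᶠ mapᵉ onFaceRow t k x }
      ; onV-mono⁻ = λ { (s , _) (k , x) refl → vertices rowᵛ⁻ mapᵉ⁻ onVertexRow⁻ s k x }
      ; onF-mono⁻ = λ { (t , _) (k , x) refl → faces rowᶠ⁻ mapᵉ⁻ onFaceRow⁻ t k x }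
      ; orientation-preserving = λ (s , _) (t , _) (k , _) → flips s t k
      }
      where
      open SymmetryTable T
      vertices : ∀ (r : Bool → Row) (e : Bool → AffineMap) →
        (∀ s k → composeᵛ (vertexRow (flipᵛ xor s) (not k)) (proj₁ (e k)) (proj₂ (e k))
               ≡ composeᵛ (r s) (vertexRow s k) zeroRow) →
        ∀ s k ((i , j) : Fin m × Fin n) →
        V.eval (vertexRow (flipᵛ xor s) (not k)) (V.eval (proj₁ (e k)) i j) (F.eval (proj₂ (e k)) j i)
        ≡ V.eval₁ (r s) (V.eval (vertexRow s k) i j)
      vertices r e eq s k (i , j) = trans (V-compose (vertexRow (flipᵛ xor s) (not k)) (proj₁ (e k)) (proj₂ (e k)) i j)
        (trans (cong (λ r → V.eval r i j) (eq s k)) (sym (V.eval₁-eval (r s) (vertexRow s k) i j)))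
      faces : ∀ (r : Bool → Row) (e : Bool → AffineMap) →
        (∀ t k → composeᶠ (faceRow (flipᶠ xor t) (not k)) (proj₂ (e k)) (proj₁ (e k))
               ≡ composeᶠ (r t) (faceRow t k) zeroRow) →
        ∀ t k ((i , j) : Fin m × Fin n) →
        F.eval (faceRow (flipᶠ xor t) (not k)) (F.eval (proj₂ (e k)) j i) (V.eval (proj₁ (e k)) i j)
        ≡ F.eval₁ (r t) (F.eval (faceRow t k) j i)
      faces r e eq t k (i , j) = trans (F-compose (faceRow (flipᶠ xor t) (not k)) (proj₂ (e k)) (proj₁ (e k)) j i)
        (trans (cong (λ r → F.eval r j i) (eq t k)) (sym (F.eval₁-eval (r t) (faceRow t k) j i)))

    -- At `f₀` orientation `false` means that the edge has the colour of `v`. The face coordinate is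
    -- 0, so only the pure part of the composed row matters.
    α-edge : ∀ v → Symmetry.onVertex (symmetry αTable) v onV edgeAt v (false , N.[ 0ℤ ]) false
    α-edge (s , i) = on s
      where
      through : Bool → Bool → Row
      through s k = composeᵛ (vertexRow (not s) k) (proj₁ (joinMap s false k)) (proj₂ (joinMap s false k))
      via : ∀ s k r → pure (through s k) ≡ r →
        let (a , b) = apply (joinMap s false k) (i , N.[ 0ℤ ]) in V.eval (vertexRow (not s) k) a b ≡ V.eval₁ r i
      via s k r eq = trans
        (V-compose (vertexRow (not s) k) (proj₁ (joinMap s false k)) (proj₂ (joinMap s false k)) i N.[ 0ℤ ])
        (trans (V.eval₁-pure (through s k) i) (cong (λ r → V.eval₁ r i) eq))
      on : ∀ s → Symmetry.onVertex (symmetry αTable) (s , i) onV edgeAt (s , i) (false , N.[ 0ℤ ]) false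
      on false = via false false identityRow refl
      on true = via true true (shift 1ℤ) refl

    β-edge : ∀ f → f onF edgeAt (false , M.[ 0ℤ ]) (Symmetry.onFace (symmetry βTable) f) false
    β-edge (t , j) = on t
      where
      through : Bool → Bool → Row
      through t k = composeᶠ (faceRow t k) (proj₂ (joinMap false (not t) k)) (proj₁ (joinMap false (not t) k))
      via : ∀ t k r → composeᶠ (pure (through t k)) r zeroRow ≡ identityRow →
        let (a , b) = apply (joinMap false (not t) k) (M.[ 0ℤ ] , F.eval₁ r j) in F.eval (faceRow t k) b a ≡ j
      via t k r eq = trans
        (F-compose (faceRow t k) (proj₂ (joinMap false (not t) k)) (proj₁ (joinMap false (not t) k)) (F.eval₁ r j) M.[ 0ℤ ])
        (trans (F.eval₁-pure (through t k) (F.eval₁ r j)) (F.eval₁-inverse (pure (through t k)) r eq j))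
      on : ∀ t → (t , j) onF edgeAt (false , M.[ 0ℤ ]) (Symmetry.onFace (symmetry βTable) (t , j)) false
      on false = via false true identityRow refl
      on true = via true false (shift 1ℤ) refl

    rotary : Rotary
    rotary = record
      { α = symmetry αTable
      ; β = symmetry βTable
      ; v₀ = false , M.[ 0ℤ ]
      ; f₀ = false , N.[ 0ℤ ]
      ; α-generates = λ Q base step (s , i) →
          V.every-residue (λ s i → Q (s , i)) base (λ i → step (false , i)) (λ i → step (true , i)) s i
      ; β-generates = λ Q base step (t , j) →
          F.every-residue (λ t j → Q (t , j)) base (λ j → step (false , j)) (λ j → step (true , j)) t j
      ; β-fixes-v₀ = cong (false ,_) (V.eval₁-scaling ⟨ -1ℤ ⨾ 1ℤ ⨾ 0ℤ ⟩)
      ; α-colour = λ _ → refl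
      ; β-colour = λ _ → refl
      ; α-edge = α-edge
      ; β-edge = β-edge
      }

    open Rotary rotary

    reflectionRow : Bool → Row
    reflectionRow false = scaling ⟨ -1ℤ ⨾ 0ℤ ⨾ 0ℤ ⟩
    -- The constant -1 comes from -(2i + 1) = 2(-i - 1) + 1.
    reflectionRow true  = row ⟨ -1ℤ ⨾ 0ℤ ⨾ 0ℤ ⟩ ⟨ 0ℤ ⨾ 0ℤ ⟩ ⟨ -1ℤ ⨾ 0ℤ ⨾ 0ℤ ⟩

    ν : Vertex → Vertex
    ν (s , i) = s , V.eval₁ (reflectionRow s) i

    φ : Face → Face
    φ (t , j) = t , F.eval₁ (reflectionRow t) j

    ν-α : ∀ v → αᵛ (ν (αᵛ v)) ≡ ν v
    ν-α (false , i) = cong (false ,_) (trans (cong (V.eval₁ (shift 1ℤ)) (V.eval₁-eval₁ (reflectionRow true) identityRow refl i))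
      (V.eval₁-eval₁ (shift 1ℤ) (reflectionRow true) refl i))
    ν-α (true , i) = cong (true ,_) (trans (cong (V.eval₁ identityRow) (V.eval₁-eval₁ (reflectionRow false) (shift 1ℤ) refl i))
      (V.eval₁-eval₁ identityRow (reflectionRow true) refl i))

    φ-β : ∀ f → βᶠ (φ (βᶠ f)) ≡ φ f
    φ-β (false , j) = cong (false ,_) (trans (cong (F.eval₁ (shift 1ℤ)) (F.eval₁-eval₁ (reflectionRow true) identityRow refl j))
      (F.eval₁-eval₁ (shift 1ℤ) (reflectionRow true) refl j))
    φ-β (true , j) = cong (true ,_) (trans (cong (F.eval₁ identityRow) (F.eval₁-eval₁ (reflectionRow false) (shift 1ℤ) refl j))
      (F.eval₁-eval₁ identityRow (reflectionRow true) refl j))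

    -- The test edge joins `v₀` to the face with j = 1. Its second vertex has coordinate -K + Kl,
    -- reflected to K + Kl - 1, but the image edge ends at K - 1. Dually, the vertex with i = 1
    -- gives -l against -l - Kl. Each difference is Kl.
    swap⇒∣ : EdgeSwap v₀ f₀ →
      + m ∣ + 2 * κ * (+ 2 * μ) × + n ∣ + 2 * μ * (+ 2 * κ)
    swap⇒∣ swap = vertices , faces
      where
      open Reversal swap ν (cong (false ,_) (V.eval₁-scaling ⟨ -1ℤ ⨾ 0ℤ ⨾ 0ℤ ⟩)) ν-α
                           φ (cong (false ,_) (F.eval₁-scaling ⟨ -1ℤ ⨾ 0ℤ ⨾ 0ℤ ⟩)) φ-β

      V-minus : V.eval₁ (reflectionRow false) M.[ 1ℤ ] ≡ M.[ -1ℤ ]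
      V-minus = trans (V.eval-[] (reflectionRow false) 1ℤ 0ℤ) (cong M.[_] (identity V.θ (V.θ * V.φ)))
        where
        identity : ∀ θ c → (-1ℤ + 0ℤ * θ + 0ℤ * c) * 1ℤ + (0ℤ * θ + 0ℤ * c) * 0ℤ + (0ℤ + 0ℤ * θ + 0ℤ * c) ≡ -1ℤ
        identity = solve-∀

      F-minus : F.eval₁ (reflectionRow false) N.[ 1ℤ ] ≡ N.[ -1ℤ ]
      F-minus = trans (F.eval-[] (reflectionRow false) 1ℤ 0ℤ) (cong N.[_] (identity F.θ (F.θ * F.φ)))
        where
        identity : ∀ θ c → (-1ℤ + 0ℤ * θ + 0ℤ * c) * 1ℤ + (0ℤ * θ + 0ℤ * c) * 0ℤ + (0ℤ + 0ℤ * θ + 0ℤ * c) ≡ -1ℤ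
        identity = solve-∀

      vertices : + m ∣ + 2 * κ * (+ 2 * μ)
      vertices = subst (+ m ∣_) (identity V.θ (V.θ * V.φ)) (M._≈_.difference
        (M.[]-injective {V.value row₁ 0ℤ 1ℤ} {V.value row₂ 0ℤ -1ℤ}
        (trans (sym left) (trans (cong proj₂ reversed) right))))
        where
        row₁ row₂ : Row
        row₁ = row ⟨ -1ℤ ⨾ 0ℤ ⨾ 0ℤ ⟩ ⟨ 1ℤ ⨾ 1ℤ ⟩ ⟨ -1ℤ ⨾ 0ℤ ⨾ 0ℤ ⟩
        row₂ = row ⟨ 1ℤ ⨾ 0ℤ ⨾ 0ℤ ⟩ ⟨ -1ℤ ⨾ 0ℤ ⟩ ⟨ -1ℤ ⨾ 0ℤ ⨾ 0ℤ ⟩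
        f : Face
        f = false , N.[ 1ℤ ]
        v w : Vertex
        v = true , Geometry.vertexOf geometry true (edgeAt v₀ f false)
        w = true , Geometry.vertexOf geometry true (edgeAt v₀ (φ f) true)
        reversed : ν v ≡ w
        reversed = reversal-vertex f v w refl refl refl refl
        left : proj₂ (ν v) ≡ M.[ V.value row₁ 0ℤ 1ℤ ]
        left = trans
          (cong (V.eval₁ (reflectionRow true)) (V-compose (vertexRow true false) identityRow identityRow M.[ 0ℤ ] N.[ 1ℤ ]))
          (trans (V.eval₁-eval (reflectionRow true) (composeᵛ (vertexRow true false) identityRow identityRow) M.[ 0ℤ ] N.[ 1ℤ ])
            (V.eval-[] row₁ 0ℤ 1ℤ))
        right : proj₂ w ≡ M.[ V.value row₂ 0ℤ -1ℤ ]
        right = trans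
          (V-compose (vertexRow true true) (proj₁ (joinMap false false true)) (proj₂ (joinMap false false true))
             M.[ 0ℤ ] (proj₂ (φ f)))
          (trans (cong (V.eval row₂ M.[ 0ℤ ]) F-minus) (V.eval-[] row₂ 0ℤ -1ℤ))
        identity : ∀ θ c →
          (-1ℤ + 0ℤ * θ + 0ℤ * c) * 0ℤ + (1ℤ * θ + 1ℤ * c) * 1ℤ + (-1ℤ + 0ℤ * θ + 0ℤ * c)
          - ((1ℤ + 0ℤ * θ + 0ℤ * c) * 0ℤ + (-1ℤ * θ + 0ℤ * c) * -1ℤ + (-1ℤ + 0ℤ * θ + 0ℤ * c)) ≡ c
        identity = solve-∀

      faces : + n ∣ + 2 * μ * (+ 2 * κ)
      faces = subst (+ n ∣_) (identity F.θ (F.θ * F.φ)) (N._≈_.difference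
        (N.[]-injective {F.value row₁ 0ℤ 1ℤ} {F.value row₂ 0ℤ -1ℤ}
        (trans (sym left) (trans (cong proj₂ reversed) right))))
        where
        row₁ row₂ : Row
        row₁ = row ⟨ -1ℤ ⨾ 0ℤ ⨾ 0ℤ ⟩ ⟨ -1ℤ ⨾ 0ℤ ⟩ ⟨ 0ℤ ⨾ 0ℤ ⨾ 0ℤ ⟩
        row₂ = row ⟨ 1ℤ ⨾ 0ℤ ⨾ 0ℤ ⟩ ⟨ 1ℤ ⨾ 1ℤ ⟩ ⟨ 0ℤ ⨾ 0ℤ ⨾ 0ℤ ⟩
        v : Vertex
        v = false , M.[ 1ℤ ]
        f g : Face
        f = true , Geometry.faceOf geometry true (edgeAt v f₀ false)
        g = true , Geometry.faceOf geometry true (edgeAt (ν v) f₀ true)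
        reversed : φ f ≡ g
        reversed = reversal-face v f g refl refl refl refl
        left : proj₂ (φ f) ≡ N.[ F.value row₁ 0ℤ 1ℤ ]
        left = trans
          (cong (F.eval₁ (reflectionRow true)) (F-compose (faceRow true false) identityRow identityRow N.[ 0ℤ ] M.[ 1ℤ ]))
          (trans (F.eval₁-eval (reflectionRow true) (composeᶠ (faceRow true false) identityRow identityRow) N.[ 0ℤ ] M.[ 1ℤ ])
            (F.eval-[] row₁ 0ℤ 1ℤ))
        right : proj₂ g ≡ N.[ F.value row₂ 0ℤ -1ℤ ]
        right = trans
          (F-compose (faceRow true true) (proj₂ (joinMap false false true)) (proj₁ (joinMap false false true))
             N.[ 0ℤ ] (proj₂ (ν v)))
          (trans (cong (F.eval row₂ N.[ 0ℤ ]) V-minus) (F.eval-[] row₂ 0ℤ -1ℤ))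
        identity : ∀ θ c →
          (-1ℤ + 0ℤ * θ + 0ℤ * c) * 0ℤ + (-1ℤ * θ + 0ℤ * c) * 1ℤ + (0ℤ + 0ℤ * θ + 0ℤ * c)
          - ((1ℤ + 0ℤ * θ + 0ℤ * c) * 0ℤ + (1ℤ * θ + 1ℤ * c) * -1ℤ + (0ℤ + 0ℤ * θ + 0ℤ * c)) ≡ c
        identity = solve-∀

    tight : TightOfType P (2 ℕ.* m) (2 ℕ.* n)
    tight = ((λ { (face f) refl → ↔-trans (face-edges f) coloured })
            , (λ { (vert v) refl → ↔-trans (vertex-edges v) coloured }))
            , subst (λ k → Flag P ↔ Fin k) count
                (↔-trans flags (↔-trans (↔-sym 2↔Bool ×-↔ (↔-trans (↔-sym 2↔Bool ×-↔
                  (↔-trans (↔-sym 2↔Bool ×-↔ ↔-sym *↔×) (↔-sym *↔×))) (↔-sym *↔×))) (↔-sym *↔×)))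
      where
      coloured : ∀ {k} → (Bool × Fin k) ↔ Fin (2 ℕ.* k)
      coloured = ↔-trans (↔-sym 2↔Bool ×-↔ ↔-refl) (↔-sym *↔×)
      count : 2 ℕ.* (2 ℕ.* (2 ℕ.* (m ℕ.* n))) ≡ 2 ℕ.* (2 ℕ.* m) ℕ.* (2 ℕ.* n)
      count = identity m n
        where
        identity : ∀ m n → 2 ℕ.* (2 ℕ.* (2 ℕ.* (m ℕ.* n))) ≡ 2 ℕ.* (2 ℕ.* m) ℕ.* (2 ℕ.* n)
        identity = ℕ-solve-∀

  -- Existence of the parameters

  halve : ∀ n → (∃ λ h → n ≡ 2 ℕ.* h) ⊎ (∃ λ h → n ≡ 1 ℕ.+ 2 ℕ.* h)
  halve zero = inj₁ (0 , refl)
  halve (suc n) with halve n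
  ... | inj₁ (h , refl) = inj₂ (h , refl)
  ... | inj₂ (h , refl) = inj₁ (ℕ.suc h , identity h)
    where
    identity : ∀ h → 1 ℕ.+ (1 ℕ.+ 2 ℕ.* h) ≡ 2 ℕ.* (1 ℕ.+ h)
    identity = ℕ-solve-∀

  odd-part : ∀ n → NonZero n → ∃₂ λ a h → n ≡ 2 ℕ.^ a ℕ.* (1 ℕ.+ 2 ℕ.* h)
  odd-part = <-rec _ λ n rec n≢0 → split n rec n≢0 (halve n)
    where
    split : ∀ n → (∀ {k} → k ℕ.< n → NonZero k → ∃₂ λ a h → k ≡ 2 ℕ.^ a ℕ.* (1 ℕ.+ 2 ℕ.* h)) → NonZero n →
      (∃ λ h → n ≡ 2 ℕ.* h) ⊎ (∃ λ h → n ≡ 1 ℕ.+ 2 ℕ.* h) → ∃₂ λ a h → n ≡ 2 ℕ.^ a ℕ.* (1 ℕ.+ 2 ℕ.* h)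
    split n rec _ (inj₂ (h , eq)) = 0 , h , trans eq (sym (ℕ.*-identityˡ _))
    split _ rec _ (inj₁ (k@(suc _) , refl)) with a , h , eq ← rec (ℕ.m<m+n k (ℕ.s≤s ℕ.z≤n)) _ =
      suc a , h , trans (cong (2 ℕ.*_) eq) (sym (ℕ.*-assoc 2 (2 ℕ.^ a) _))

  -- By repeated squaring.
  idempotent : ∀ h a → let x = 1ℤ + + 2 * h in ∃ λ E → ∃₂ λ q t → E ≡ x * q × E ≡ 1ℤ + + 2 * (+ (2 ℕ.^ a) * t)
  idempotent h zero = 1ℤ + + 2 * h , 1ℤ , h , sym (ℤ.*-identityʳ _) , cong (λ z → 1ℤ + + 2 * z) (sym (ℤ.*-identityˡ h))
  idempotent h (suc a) with E , q , t , eq , eq′ ← idempotent h a =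
    E * E , q * E , t + p * (t * t)
    , trans (cong (_* E) eq) (ℤ.*-assoc (1ℤ + + 2 * h) q E)
    , trans (cong₂ _*_ eq′ eq′) (trans (identity p t)
        (cong (λ z → 1ℤ + + 2 * (z * (t + p * (t * t)))) (sym (ℤ.pos-* 2 (2 ℕ.^ a)))))
    where
    p : ℤ
    p = + (2 ℕ.^ a)
    identity : ∀ p t → (1ℤ + + 2 * (p * t)) * (1ℤ + + 2 * (p * t)) ≡ 1ℤ + + 2 * (+ 2 * p * (t + p * (t * t)))
    identity = solve-∀

  odd≢even : ∀ {x y} → 1ℤ + + 2 * x ≢ + 2 * y
  odd≢even {x} {y} eq = 2≢1 (∣1⇒≡1 (∣⇒∣ᵤ {+ 2} {1ℤ}
      (divides (y - x) (trans (identity x) (trans (cong (_- + 2 * x) eq) (identity′ x y))))))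
    where
    2≢1 : 2 ≢ 1
    2≢1 ()
    identity : ∀ x → 1ℤ ≡ 1ℤ + + 2 * x - + 2 * x
    identity = solve-∀
    identity′ : ∀ x y → + 2 * y - + 2 * x ≡ (y - x) * + 2
    identity′ = solve-∀

  odd-nonZero : ∀ x → ℤ.NonZero (1ℤ + + 2 * x)
  odd-nonZero x = ℤ.≢-nonZero (λ eq → odd≢even {x} {0ℤ} eq)

  -- The modulus 2c is a common multiple of X and Y in which E is idempotent; as X = u x and Y = 4 w y
  -- with x, y odd and u ∣ 4 w, the 2-part of Y is that of 2c.
  record Splitting (X Y : ℤ) : Set where
    field
      c E : ℤ
      X∣2c : X ∣ + 2 * c
      Y∣2c : Y ∣ + 2 * c
      idem : + 2 * c ∣ E * (E - 1ℤ)
      absorb : + 2 * c ∣ c * (E - 1ℤ)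
      X∣YE : X ∣ Y * E
      Y∤c[c+E] : ¬ (Y ∣ c * (c + E))
      Y∤c[c-E] : ¬ (Y ∣ c * (c - E))

  splitting : ∀ u d b h k → + 4 * + (2 ℕ.^ b) ≡ u * d →
    Splitting (u * (1ℤ + + 2 * h)) (+ 4 * + (2 ℕ.^ b) * (1ℤ + + 2 * k))
  -- `h + k + + 2 * (h * k)` is the half of xy - 1, so `E` is a multiple of xy; the exponent `suc b`
  -- makes it 1 modulo 4w.
  splitting u d b h k eq with E , q , t , E≡ , E≡′ ← idempotent (h + k + + 2 * (h * k)) (suc b) = record
    { c = c
    ; E = E
    ; X∣2c = divides (d * y) (trans (twice w x y) (trans (cong (λ z → z * x * y) eq) (X-multiple u d x y)))
    ; Y∣2c = divides x (trans (twice w x y) (Y-multiple w x y))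
    ; idem = divides (q * t) (trans (cong (_* (E - 1ℤ)) E≡) (trans
        (cong (λ z → (1ℤ + + 2 * (h + k + + 2 * (h * k))) * q * (z - 1ℤ)) (unfold E≡′)) (E-multiple w h k q t)))
    ; absorb = divides (+ 2 * w * t) (trans (cong (λ z → c * (z - 1ℤ)) (unfold E≡′)) (c-multiple c w t))
    ; X∣YE = divides (d * y * y * q) (trans (cong (λ z → + 4 * w * y * z) E≡)
        (trans (cong (λ z → z * y * ((1ℤ + + 2 * (h + k + + 2 * (h * k))) * q)) eq) (YE-multiple u d h k q)))
    -- Since c is even and E odd, c(c + E) is 2wy times an odd number, while a multiple of Y = 4wy
    -- is 2wy times an even one.
    ; Y∤c[c+E] = λ (divides z e) → odd≢even {h + (1ℤ + + 2 * h) * (w * x * y + + 2 * w * t)} {z}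
        (ℤ.*-cancelˡ-≡ (+ 2 * w * y) _ _ {{nz}} (trans
          (sym (trans (cong (λ z → c * (c + z)) (unfold E≡′)) (plus w h k t)))
          (trans e (times w y z))))
    ; Y∤c[c-E] = λ (divides z e) → odd≢even {h + (1ℤ + + 2 * h) * (w * x * y - + 2 * w * t - 1ℤ)} {z}
        (ℤ.*-cancelˡ-≡ (+ 2 * w * y) _ _ {{nz}} (trans
          (sym (trans (cong (λ z → c * (c - z)) (unfold E≡′)) (minus w h k t)))
          (trans e (times w y z))))
    }
    where
    w x y c : ℤ
    w = + (2 ℕ.^ b)
    x = 1ℤ + + 2 * h
    y = 1ℤ + + 2 * k
    c = + 2 * w * x * y
    nz : ℤ.NonZero (+ 2 * w * y)
    nz = ℤ.i*j≢0 (+ 2 * w) y {{ℤ.i*j≢0 (+ 2) w {{_}} {{ℕ.m^n≢0 2 b}}}} {{odd-nonZero k}}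
    unfold : ∀ {E t} → E ≡ 1ℤ + + 2 * (+ (2 ℕ.^ suc b) * t) → E ≡ 1ℤ + + 4 * w * t
    unfold {t = t} e = trans e (trans (cong (λ z → 1ℤ + + 2 * (z * t)) (ℤ.pos-* 2 (2 ℕ.^ b))) (quadruple w t))
      where
      quadruple : ∀ w t → 1ℤ + + 2 * (+ 2 * w * t) ≡ 1ℤ + + 4 * w * t
      quadruple = solve-∀
    twice : ∀ w x y → + 2 * (+ 2 * w * x * y) ≡ + 4 * w * x * y
    twice = solve-∀
    X-multiple : ∀ u d x y → u * d * x * y ≡ d * y * (u * x)
    X-multiple = solve-∀
    Y-multiple : ∀ w x y → + 4 * w * x * y ≡ x * (+ 4 * w * y)
    Y-multiple = solve-∀
    E-multiple : ∀ w h k q t → (1ℤ + + 2 * (h + k + + 2 * (h * k))) * q * (1ℤ + + 4 * w * t - 1ℤ)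
      ≡ q * t * (+ 2 * (+ 2 * w * (1ℤ + + 2 * h) * (1ℤ + + 2 * k)))
    E-multiple = solve-∀
    c-multiple : ∀ c w t → c * (1ℤ + + 4 * w * t - 1ℤ) ≡ + 2 * w * t * (+ 2 * c)
    c-multiple = solve-∀
    YE-multiple : ∀ u d h k q → u * d * (1ℤ + + 2 * k) * ((1ℤ + + 2 * (h + k + + 2 * (h * k))) * q)
      ≡ d * (1ℤ + + 2 * k) * (1ℤ + + 2 * k) * q * (u * (1ℤ + + 2 * h))
    YE-multiple = solve-∀
    plus : ∀ w h k t → let x = 1ℤ + + 2 * h ; y = 1ℤ + + 2 * k ; c = + 2 * w * x * y in
      c * (c + (1ℤ + + 4 * w * t)) ≡ + 2 * w * y * (1ℤ + + 2 * (h + (1ℤ + + 2 * h) * (w * x * y + + 2 * w * t)))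
    plus = solve-∀
    minus : ∀ w h k t → let x = 1ℤ + + 2 * h ; y = 1ℤ + + 2 * k ; c = + 2 * w * x * y in
      c * (c - (1ℤ + + 4 * w * t)) ≡ + 2 * w * y * (1ℤ + + 2 * (h + (1ℤ + + 2 * h) * (w * x * y - + 2 * w * t - 1ℤ)))
    minus = solve-∀
    times : ∀ w y z → z * (+ 4 * w * y) ≡ + 2 * w * y * (+ 2 * z)
    times = solve-∀

  -- The conditions on K = 2κ and l = 2μ modulo 4r and 4S, divided by 4.
  record Parameters (r S : ℤ) : Set where
    field
      κ μ : ℤ
      square-κ : r ∣ κ * (κ - 1ℤ - μ)
      square-μ : S ∣ μ * (μ + 1ℤ - κ)
      double-r : r ∣ + 2 * (κ * μ)
      double-S : S ∣ + 2 * (κ * μ)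
      annihilates-κ : r ∣ + 2 * (κ * S)
      annihilates-μ : S ∣ + 2 * (μ * r)
      nonzero : ¬ (r ∣ κ * μ × S ∣ κ * μ)

  -- If the 2-part of r divides that of S, take μ = c and κ = c + E; otherwise κ = c and μ = c − E.
  parameters-≤ : ∀ {r S} → Splitting r S → Parameters r S
  parameters-≤ {r} {S} split = record
    { κ = c + E
    ; μ = c
    ; square-κ = ∣-trans X∣2c (subst (+ 2 * c ∣_) (eq₁ c E) (∣m∣n⇒∣m+n absorb idem))
    ; square-μ = ∣-trans Y∣2c (subst (+ 2 * c ∣_) (eq₂ c E) (∣m⇒∣-m absorb))
    ; double-r = subst (r ∣_) (eq₃ c (c + E)) (∣n⇒∣m*n (c + E) X∣2c)
    ; double-S = subst (S ∣_) (eq₃ c (c + E)) (∣n⇒∣m*n (c + E) Y∣2c)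
    ; annihilates-κ = subst (r ∣_) (eq₄ c E S) (∣m∣n⇒∣m+n (∣n⇒∣m*n S X∣2c) (∣n⇒∣m*n (+ 2) X∣YE))
    ; annihilates-μ = subst (S ∣_) (eq₅ c r) (∣n⇒∣m*n r Y∣2c)
    ; nonzero = λ (_ , d) → Y∤c[c+E] (subst (S ∣_) (ℤ.*-comm (c + E) c) d)
    }
    where
    open Splitting split
    eq₁ : ∀ c E → c * (E - 1ℤ) + E * (E - 1ℤ) ≡ (c + E) * (c + E - 1ℤ - c)
    eq₁ = solve-∀
    eq₂ : ∀ c E → - (c * (E - 1ℤ)) ≡ c * (c + 1ℤ - (c + E))
    eq₂ = solve-∀
    eq₃ : ∀ c z → z * (+ 2 * c) ≡ + 2 * (z * c)
    eq₃ = solve-∀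
    eq₄ : ∀ c E S → S * (+ 2 * c) + + 2 * (S * E) ≡ + 2 * ((c + E) * S)
    eq₄ = solve-∀
    eq₅ : ∀ c r → r * (+ 2 * c) ≡ + 2 * (c * r)
    eq₅ = solve-∀

  parameters-≥ : ∀ {r S} → Splitting S r → Parameters r S
  parameters-≥ {r} {S} split = record
    { κ = c
    ; μ = c - E
    ; square-κ = ∣-trans Y∣2c (subst (+ 2 * c ∣_) (eq₁ c E) absorb)
    ; square-μ = ∣-trans X∣2c (subst (+ 2 * c ∣_) (eq₂ c E) (∣m∣n⇒∣m-n idem absorb))
    ; double-r = subst (r ∣_) (eq₃ c (c - E)) (∣n⇒∣m*n (c - E) Y∣2c)
    ; double-S = subst (S ∣_) (eq₃ c (c - E)) (∣n⇒∣m*n (c - E) X∣2c)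
    ; annihilates-κ = subst (r ∣_) (eq₃ c S) (∣n⇒∣m*n S Y∣2c)
    ; annihilates-μ = subst (S ∣_) (eq₄ c E r) (∣m∣n⇒∣m-n (∣n⇒∣m*n r X∣2c) (∣n⇒∣m*n (+ 2) X∣YE))
    ; nonzero = λ (d , _) → Y∤c[c-E] d
    }
    where
    open Splitting split
    eq₁ : ∀ c E → c * (E - 1ℤ) ≡ c * (c - 1ℤ - (c - E))
    eq₁ = solve-∀
    eq₂ : ∀ c E → E * (E - 1ℤ) - c * (E - 1ℤ) ≡ (c - E) * (c - E + 1ℤ - c)
    eq₂ = solve-∀
    eq₃ : ∀ c z → z * (+ 2 * c) ≡ + 2 * (c * z)
    eq₃ = solve-∀
    eq₄ : ∀ c E r → r * (+ 2 * c) - + 2 * (r * E) ≡ + 2 * ((c - E) * r)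
    eq₄ = solve-∀

  2^-+ : ∀ a b → + (2 ℕ.^ (a ℕ.+ b)) ≡ + (2 ℕ.^ a) * + (2 ℕ.^ b)
  2^-+ a b = trans (cong +_ (ℕ.^-distribˡ-+-* 2 a b)) (ℤ.pos-* (2 ℕ.^ a) (2 ℕ.^ b))

  odd-part-ℤ : ∀ {n} a h → n ≡ 2 ℕ.^ a ℕ.* (1 ℕ.+ 2 ℕ.* h) → + n ≡ + (2 ℕ.^ a) * (1ℤ + + 2 * + h)
  odd-part-ℤ a h eq = trans (cong +_ eq) (trans (ℤ.pos-* (2 ℕ.^ a) (1 ℕ.+ 2 ℕ.* h))
    (cong (λ z → + (2 ℕ.^ a) * (1ℤ + z)) (ℤ.pos-* 2 h)))

  parameters : ∀ r s → NonZero r → NonZero s → Parameters (+ r) (+ 4 * + s)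
  parameters r s r≢0 s≢0 with odd-part r r≢0 | odd-part s s≢0
  -- The exponent of 2 in 4s is `2 ℕ.+ b`.
  ... | a , h , r≡ | b , k , s≡ = compare (ℕ.≤-total a (2 ℕ.+ b))
    where
    S≡ : + 4 * + s ≡ + 4 * + (2 ℕ.^ b) * (1ℤ + + 2 * + k)
    S≡ = trans (cong (+ 4 *_) (odd-part-ℤ b k s≡)) (sym (ℤ.*-assoc (+ 4) (+ (2 ℕ.^ b)) (1ℤ + + 2 * + k)))
    compare : a ℕ.≤ 2 ℕ.+ b ⊎ 2 ℕ.+ b ℕ.≤ a → Parameters (+ r) (+ 4 * + s)
    compare (inj₁ a≤) with e , a+e ← ℕ.m≤n⇒∃[o]m+o≡n a≤ =
      subst₂ Parameters (sym (odd-part-ℤ a h r≡)) (sym S≡)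
        (parameters-≤ (splitting (+ (2 ℕ.^ a)) (+ (2 ℕ.^ e)) b (+ h) (+ k)
          (trans (sym (2^-+ 2 b)) (trans (cong (λ z → + (2 ℕ.^ z)) (sym a+e)) (2^-+ a e)))))
    compare (inj₂ a≥) with e , a+e ← ℕ.m≤n⇒∃[o]m+o≡n a≥ =
      subst₂ Parameters
        (sym (trans (odd-part-ℤ a h r≡)
          (cong (_* (1ℤ + + 2 * + h)) (trans (cong (λ z → + (2 ℕ.^ z)) (sym a+e)) (2^-+ 2 (b ℕ.+ e))))))
        (sym S≡)
        -- Now 4s plays the part of X and r that of Y: a = 2 + (b + e) exhibits the 2-part of r as 4
        -- times a power of 2.
        (parameters-≥ (splitting (+ 4 * + (2 ℕ.^ b)) (+ (2 ℕ.^ e)) (b ℕ.+ e) (+ k) (+ h)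
          (trans (cong (+ 4 *_) (2^-+ b e)) (sym (ℤ.*-assoc (+ 4) (+ (2 ℕ.^ b)) (+ (2 ℕ.^ e)))))))

-- From congruences modulo r and 4s to the moduli 4r and 16s

open import Data.Nat using (_*_)

lift-∣ : ∀ {m d z w} → m ≡ + 4 ℤ.* d → d ∣ z → + 4 ℤ.* z ≡ w → m ∣ w
lift-∣ refl d∣z refl = *-monoʳ-∣ (+ 4) d∣z

lower-∣ : ∀ {m d z w} → m ≡ + 4 ℤ.* d → m ∣ w → + 4 ℤ.* z ≡ w → d ∣ z
lower-∣ refl m∣w refl = *-cancelˡ-∣ (+ 4) m∣w

theorem3p14 : (r s : ℕ) → NonZero r → NonZero s →
    Σ Polyhedron (λ P → TightOfType (proj₁ P) (8 * r) (32 * s) × Chiral (proj₁ P))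
theorem3p14 r s r≢0 s≢0 =
  (GeometryPoset.P geometry , GeometryPoset.Rotary.isPolyhedron rotary)
  , subst₂ (TightOfType (GeometryPoset.P geometry)) (sym (ℕ.*-assoc 2 4 r)) (sym (ℕ.*-assoc 2 16 s)) tight
  , GeometryPoset.Rotary.chiral rotary (λ swap → let (p , q) = swap⇒∣ swap in nonzero
      (lower-∣ m≡ p (eq₆ κ μ) , lower-∣ n≡ q (eq₇ κ μ)))
  where
  open Parameters (parameters r s r≢0 s≢0)
  m≡ : + (4 * r) ≡ + 4 ℤ.* + r
  m≡ = ℤ.pos-* 4 r
  n≡ : + (16 * s) ≡ + 4 ℤ.* (+ 4 ℤ.* + s)
  n≡ = trans (ℤ.pos-* 16 s) (ℤ.*-assoc (+ 4) (+ 4) (+ s))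
  eq₁ : ∀ κ μ → + 4 ℤ.* (κ ℤ.* (κ ℤ.- 1ℤ ℤ.- μ))
    ≡ + 2 ℤ.* κ ℤ.* (+ 2 ℤ.* κ) ℤ.- (+ 2 ℤ.* 1ℤ ℤ.* (+ 2 ℤ.* κ) ℤ.+ + 2 ℤ.* κ ℤ.* (+ 2 ℤ.* μ))
  eq₁ = solve-∀
  eq₂ : ∀ κ μ → + 4 ℤ.* (μ ℤ.* (μ ℤ.+ 1ℤ ℤ.- κ))
    ≡ + 2 ℤ.* μ ℤ.* (+ 2 ℤ.* μ) ℤ.- (+ 2 ℤ.* -1ℤ ℤ.* (+ 2 ℤ.* μ) ℤ.+ + 2 ℤ.* μ ℤ.* (+ 2 ℤ.* κ))
  eq₂ = solve-∀
  eq₃ : ∀ κ μ → + 4 ℤ.* (+ 2 ℤ.* (κ ℤ.* μ)) ≡ + 2 ℤ.* (+ 2 ℤ.* κ ℤ.* (+ 2 ℤ.* μ))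
  eq₃ = solve-∀
  eq₄ : ∀ κ μ → + 4 ℤ.* (+ 2 ℤ.* (κ ℤ.* μ)) ≡ + 2 ℤ.* (+ 2 ℤ.* μ ℤ.* (+ 2 ℤ.* κ))
  eq₄ = solve-∀
  eq₅ : ∀ κ s → + 4 ℤ.* (+ 2 ℤ.* (κ ℤ.* s)) ≡ + 2 ℤ.* κ ℤ.* (+ 4 ℤ.* s)
  eq₅ = solve-∀
  eq₆ : ∀ κ μ → + 4 ℤ.* (κ ℤ.* μ) ≡ + 2 ℤ.* κ ℤ.* (+ 2 ℤ.* μ)
  eq₆ = solve-∀
  eq₇ : ∀ κ μ → + 4 ℤ.* (κ ℤ.* μ) ≡ + 2 ℤ.* μ ℤ.* (+ 2 ℤ.* κ)
  eq₇ = solve-∀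
  open Model (4 * r) (16 * s) {{ℕ.m*n≢0 4 r {{_}} {{r≢0}}}} {{ℕ.m*n≢0 16 s {{_}} {{s≢0}}}} κ μ
    (lift-∣ m≡ square-κ (eq₁ κ μ)) (lift-∣ n≡ square-μ (eq₂ κ μ))
    (lift-∣ m≡ double-r (eq₃ κ μ)) (lift-∣ n≡ double-S (eq₄ κ μ))
    (lift-∣ m≡ annihilates-κ (trans (eq₅ κ (+ 4 ℤ.* + s)) (cong (+ 2 ℤ.* κ ℤ.*_) (sym n≡))))
    (lift-∣ n≡ annihilates-μ (trans (eq₅ μ (+ r)) (cong (+ 2 ℤ.* μ ℤ.*_) (sym m≡))))
    using (geometry; rotary; tight; swap⇒∣)
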